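{- Let $n\ge 1$ and $d,\ell\ge 0$ be integers with $d\equiv\ell\pmod 2$. Then the bounded function $f:\{\pm1\}^n\to[-1,1]$ given by $f(x)=T_d\big((x_1+\dots+x_n)/n\big)$ satisfies $$\|f_\ell\|_\infty\ \ge\ |C(d,\ell)|-\frac{2e^d\,(d+1)!}{n}.$$
   Context: Every $f:\{\pm1\}^n\to\mathbb{R}$ is uniquely written as $f(x)=\sum_{S\subseteq[n]}\hat f(S)\chi_S(x)$ with $\chi_S(x)=\prod_{j\in S}x_j$ and $\hat f(S)\in\mathbb{R}$. The $\ell$-th homogeneous part is $f_\ell(x)=\sum_{S\subseteq[n],\,|S|=\ell}\hat f(S)\chi_S(x)$, and $\|f_\ell\|_\infty=\max_{x\in\{\pm1\}^n}|f_\ell(x)|$. $T_d(z)$ is the Chebyshev polynomial of degree $d$, the unique polynomial of degree $d$ with $T_d(\cos\theta)=\cos(d\theta)$, and $C(d,\ell)$ is the coefficient of $z^\ell$ in $T_d(z)$. -}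

module Defs where

open import Algebra.Bundles using (CommutativeRing)
open import Data.Fin.Subset using (Subset; inside; outside) renaming (∣_∣ to card)
open import Data.Integer.Base as ℤ using (+_)
open import Data.List.Base using (List; []; _∷_; _++_; map; filter; foldr)
open import Data.Nat.Base as ℕ using (ℕ; zero; suc; NonZero; z≤n; s≤s; _!)
import Data.Nat.Properties as ℕₚ
open import Data.Nat.Solver renaming (module +-*-Solver to ℕ-Solver)
open import Data.Product.Base using (_×_; _,_; proj₁; proj₂; ∃-syntax)
open import Data.Rational.Base using (ℚ; 0ℚ; 1ℚ; ½; _/_; _+_; _*_; _-_; -_; _≤_; _<_; _⊔_; ∣_∣; 1/_; Positive; NonNegative; positive; nonNegative)
import Data.Rational.Base as ℚ
open import Data.Rational.Properties as ℚₚ using (+-*-commutativeRing)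
open import Data.Rational.Solver using (module +-*-Solver)
open import Data.Sign.Base using (Sign)
open import Data.Sum.Base using (inj₁; inj₂)
open import Data.Rational.Unnormalised.Base as ℚᵘ using (mkℚᵘ; *≡*)
import Data.Rational.Unnormalised.Properties as ℚᵘₚ
open import Data.Vec.Base using (Vec; []; _∷_)
import Data.Vec.Base as Vec
open import Function.Base using (_∘_)
open import Relation.Binary.PropositionalEquality using (_≡_; refl; sym; trans; cong; cong₂; module ≡-Reasoning)

-- Polynomials are lists of coefficients, constant term first.

module Polynomial {c ℓ} (R : CommutativeRing c ℓ) where

  open CommutativeRing R
    renaming (_+_ to _⊞_; _*_ to _⊠_; -_ to ⊟_; _-_ to _⊟_; refl to ≈-refl; sym to ≈-sym; trans to ≈-trans)
  open import Relation.Binary.Reasoning.Setoid setoid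
  open import Algebra.Properties.Semiring.Exp semiring using (_^_)
  open import Algebra.Properties.Ring ring using (-‿distribˡ-*; -‿distribʳ-*; -‿+-comm; -0#≈0#)
  open import Algebra.Solver.Ring.NaturalCoefficients.Default commutativeSemiring using (solve; _:=_; _:+_; _:*_)

  Poly : Set c
  Poly = List Carrier

  coeff : Poly → ℕ → Carrier
  coeff []      _       = 0#
  coeff (a ∷ _) zero    = a
  coeff (_ ∷ p) (suc k) = coeff p k

  eval : Poly → Carrier → Carrier
  eval []      z = 0#
  eval (a ∷ p) z = a ⊞ z ⊠ eval p z

  addᴾ : Poly → Poly → Poly
  addᴾ []      q       = q
  addᴾ (a ∷ p) []      = a ∷ p
  addᴾ (a ∷ p) (b ∷ q) = (a ⊞ b) ∷ addᴾ p q

  scaleᴾ : Carrier → Poly → Poly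
  scaleᴾ a = map (a ⊠_)

  -- T d is characterised by its degree (`T-degree`, `T-leading`) and by
  -- T_d (cos θ) = cos (d θ), which is `T-multiple-angle`.

  T : ℕ → Poly
  T zero          = 1# ∷ []
  T (suc zero)    = 0# ∷ 1# ∷ []
  T (suc (suc d)) = addᴾ (scaleᴾ (1# ⊞ 1#) (0# ∷ T (suc d))) (scaleᴾ (⊟ 1#) (T d))

  -- An angle θ is given by the point (c , s) = (cos θ , sin θ) of the unit
  -- circle, and `multiple c s d` is then (cos (d θ) , sin (d θ)), i.e. the real
  -- and imaginary parts of (c + i s)ᵈ.

  multiple : Carrier → Carrier → ℕ → Carrier × Carrier
  multiple c s zero    = 1# , 0#
  multiple c s (suc d) = let (a , b) = multiple c s d in c ⊠ a ⊟ s ⊠ b , s ⊠ a ⊞ c ⊠ b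

  eval-add : ∀ p q z → eval (addᴾ p q) z ≈ eval p z ⊞ eval q z
  eval-add []      q       z = ≈-sym (+-identityˡ _)
  eval-add (a ∷ p) []      z = ≈-sym (+-identityʳ _)
  eval-add (a ∷ p) (b ∷ q) z = begin
    (a ⊞ b) ⊞ z ⊠ eval (addᴾ p q) z          ≈⟨ +-congˡ (*-congˡ (eval-add p q z)) ⟩
    (a ⊞ b) ⊞ z ⊠ (eval p z ⊞ eval q z)      ≈⟨ solve 5 (λ a b z x y → ((a :+ b) :+ z :* (x :+ y)) := ((a :+ z :* x) :+ (b :+ z :* y))) ≈-refl a b z (eval p z) (eval q z) ⟩
    (a ⊞ z ⊠ eval p z) ⊞ (b ⊞ z ⊠ eval q z)  ∎

  eval-scale : ∀ a p z → eval (scaleᴾ a p) z ≈ a ⊠ eval p z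
  eval-scale a []      z = ≈-sym (zeroʳ a)
  eval-scale a (b ∷ p) z = begin
    a ⊠ b ⊞ z ⊠ eval (scaleᴾ a p) z  ≈⟨ +-congˡ (*-congˡ (eval-scale a p z)) ⟩
    a ⊠ b ⊞ z ⊠ (a ⊠ eval p z)       ≈⟨ solve 4 (λ a b z x → (a :* b :+ z :* (a :* x)) := (a :* (b :+ z :* x))) ≈-refl a b z (eval p z) ⟩
    a ⊠ (b ⊞ z ⊠ eval p z)           ∎

  coeff-add : ∀ p q k → coeff (addᴾ p q) k ≈ coeff p k ⊞ coeff q k
  coeff-add []      q       k       = ≈-sym (+-identityˡ _)
  coeff-add (a ∷ p) []      k       = ≈-sym (+-identityʳ _)
  coeff-add (a ∷ p) (b ∷ q) zero    = ≈-refl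
  coeff-add (a ∷ p) (b ∷ q) (suc k) = coeff-add p q k

  coeff-scale : ∀ a p k → coeff (scaleᴾ a p) k ≈ a ⊠ coeff p k
  coeff-scale a []      k       = ≈-sym (zeroʳ a)
  coeff-scale a (b ∷ p) zero    = ≈-refl
  coeff-scale a (b ∷ p) (suc k) = coeff-scale a p k

  coeff-T : ∀ d k → coeff (T (suc (suc d))) (suc k) ≈
            (1# ⊞ 1#) ⊠ coeff (T (suc d)) k ⊞ (⊟ 1#) ⊠ coeff (T d) (suc k)
  coeff-T d k = ≈-trans
    (coeff-add (scaleᴾ (1# ⊞ 1#) (0# ∷ T (suc d))) (scaleᴾ (⊟ 1#) (T d)) (suc k))
    (+-cong (coeff-scale _ (T (suc d)) k) (coeff-scale _ (T d) (suc k)))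

  T-degree : ∀ d k → d ℕ.< k → coeff (T d) k ≈ 0#
  T-degree zero          (suc k)       _         = ≈-refl
  T-degree (suc zero)    (suc zero)    (s≤s ())
  T-degree (suc zero)    (suc (suc k)) _         = ≈-refl
  T-degree (suc (suc d)) (suc k)       (s≤s d<k) = ≈-trans (coeff-T d k) (≈-trans
    (+-cong (≈-trans (*-congˡ (T-degree (suc d) k d<k)) (zeroʳ _))
            (≈-trans (*-congˡ (T-degree d (suc k) (ℕₚ.m≤n⇒m≤1+n (ℕₚ.<⇒≤ d<k)))) (zeroʳ _)))
    (+-identityˡ 0#))

  T-leading : ∀ d → coeff (T (suc d)) (suc d) ≈ (1# ⊞ 1#) ^ d
  T-leading zero    = ≈-refl
  T-leading (suc d) = ≈-trans (coeff-T d (suc d)) (≈-trans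
    (+-cong (*-congˡ (T-leading d))
            (≈-trans (*-congˡ (T-degree d (suc (suc d)) (ℕₚ.m≤n⇒m≤1+n ℕₚ.≤-refl))) (zeroʳ _)))
    (+-identityʳ _))

  T-multiple-angle : ∀ c s → c ⊠ c ⊞ s ⊠ s ≈ 1# →
                     ∀ d → eval (T d) c ≈ proj₁ (multiple c s d)
  T-multiple-angle c s cs zero = ≈-trans (+-congˡ (zeroʳ c)) (+-identityʳ 1#)
  T-multiple-angle c s cs (suc zero) = begin
    0# ⊞ c ⊠ (1# ⊞ c ⊠ 0#)  ≈⟨ +-identityˡ _ ⟩
    c ⊠ (1# ⊞ c ⊠ 0#)       ≈⟨ *-congˡ (≈-trans (+-congˡ (zeroʳ c)) (+-identityʳ 1#)) ⟩
    c ⊠ 1#                  ≈⟨ ≈-sym (+-identityʳ _) ⟩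
    c ⊠ 1# ⊞ 0#             ≈⟨ +-congˡ (≈-sym (≈-trans (-‿cong (zeroʳ s)) -0#≈0#)) ⟩
    c ⊠ 1# ⊟ s ⊠ 0#         ∎
  T-multiple-angle c s cs (suc (suc d)) = begin
    eval (T (suc (suc d))) c
      ≈⟨ eval-add (scaleᴾ (1# ⊞ 1#) (0# ∷ T (suc d))) (scaleᴾ (⊟ 1#) (T d)) c ⟩
    eval (scaleᴾ (1# ⊞ 1#) (0# ∷ T (suc d))) c ⊞ eval (scaleᴾ (⊟ 1#) (T d)) c
      ≈⟨ +-cong (eval-scale _ (0# ∷ T (suc d)) c) (eval-scale _ (T d) c) ⟩
    (1# ⊞ 1#) ⊠ (0# ⊞ c ⊠ eval (T (suc d)) c) ⊞ (⊟ 1#) ⊠ eval (T d) c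
      ≈⟨ +-cong (*-congˡ (≈-trans (+-identityˡ _) (*-congˡ (T-multiple-angle c s cs (suc d)))))
                (≈-trans (≈-sym (-‿distribˡ-* _ _)) (-‿cong (≈-trans (*-identityˡ _) (T-multiple-angle c s cs d)))) ⟩
    (1# ⊞ 1#) ⊠ (c ⊠ A) ⊞ ⊟ a
      ≈⟨ +-cong (≈-trans (distribʳ _ _ _) (+-cong (*-identityˡ _) (*-identityˡ _)))
                (-‿cong (≈-trans (≈-sym (*-identityˡ a)) (*-congʳ (≈-sym cs)))) ⟩
    (c ⊠ A ⊞ c ⊠ A) ⊞ ⊟ ((c ⊠ c ⊞ s ⊠ s) ⊠ a)
      ≈⟨ +-assoc _ _ _ ⟩
    c ⊠ A ⊞ (c ⊠ A ⊞ ⊟ ((c ⊠ c ⊞ s ⊠ s) ⊠ a))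
      ≈⟨ +-congˡ (+-congˡ (-‿cong (solve 4 (λ c s a b → ((c :* c :+ s :* s) :* a) := (c :* (c :* a) :+ s :* (s :* a))) ≈-refl c s a b))) ⟩
    c ⊠ A ⊞ (c ⊠ A ⊞ ⊟ (c ⊠ (c ⊠ a) ⊞ s ⊠ (s ⊠ a)))
      ≈⟨ +-congˡ rearrange ⟩
    c ⊠ A ⊞ ((c ⊠ (c ⊠ a) ⊞ ⊟ (c ⊠ (c ⊠ a))) ⊞ ⊟ (s ⊠ B))
      ≈⟨ +-congˡ (≈-trans (+-congʳ (-‿inverseʳ _)) (+-identityˡ _)) ⟩
    c ⊠ A ⊟ s ⊠ B ∎
    where
    a = proj₁ (multiple c s d)
    b = proj₂ (multiple c s d)
    A = proj₁ (multiple c s (suc d))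
    B = proj₂ (multiple c s (suc d))
    cca = c ⊠ (c ⊠ a)
    ssa = s ⊠ (s ⊠ a)
    scb = s ⊠ (c ⊠ b)
    rearrange : c ⊠ A ⊞ ⊟ (cca ⊞ ssa) ≈ (cca ⊞ ⊟ cca) ⊞ ⊟ (s ⊠ B)
    rearrange = begin
      c ⊠ (c ⊠ a ⊟ s ⊠ b) ⊞ ⊟ (cca ⊞ ssa)
        ≈⟨ +-cong (≈-trans (distribˡ _ _ _) (+-congˡ (≈-trans (≈-sym (-‿distribʳ-* _ _))
                    (-‿cong (solve 3 (λ c s b → (c :* (s :* b)) := (s :* (c :* b))) ≈-refl c s b)))))
                  (≈-sym (-‿+-comm _ _)) ⟩
      (cca ⊞ ⊟ scb) ⊞ (⊟ cca ⊞ ⊟ ssa)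
        ≈⟨ solve 4 (λ p y q z → ((p :+ y) :+ (q :+ z)) := ((p :+ q) :+ (z :+ y))) ≈-refl cca (⊟ scb) (⊟ cca) (⊟ ssa) ⟩
      (cca ⊞ ⊟ cca) ⊞ (⊟ ssa ⊞ ⊟ scb)
        ≈⟨ +-congˡ (≈-trans (-‿+-comm _ _) (-‿cong (≈-sym (distribˡ _ _ _)))) ⟩
      (cca ⊞ ⊟ cca) ⊞ ⊟ (s ⊠ B) ∎

open Polynomial +-*-commutativeRing using (coeff; eval; T)

C : ℕ → ℕ → ℚ
C d ℓ = coeff (T d) ℓ

Point : ℕ → Set
Point = Vec Sign

coord : Sign → ℚ
coord Sign.+ = 1ℚ
coord Sign.- = - 1ℚ

χ : ∀ {n} → Subset n → Point n → ℚ
χ []            []      = 1ℚ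
χ (inside  ∷ S) (s ∷ x) = coord s * χ S x
χ (outside ∷ S) (s ∷ x) = χ S x

points : ∀ n → List (Point n)
points zero    = [] ∷ []
points (suc n) = map (Sign.+ ∷_) (points n) ++ map (Sign.- ∷_) (points n)

subsets : ∀ n → List (Subset n)
subsets zero    = [] ∷ []
subsets (suc n) = map (outside ∷_) (subsets n) ++ map (inside ∷_) (subsets n)

∑ : ∀ {A : Set} → List A → (A → ℚ) → ℚ
∑ as g = foldr (λ a r → g a + r) 0ℚ as

-- The Fourier coefficients, by splitting f into its parts even and odd in the
-- first variable; `fourier-expansion` and `fourier-unique` characterise them.

f̂ : ∀ {n} → (Point n → ℚ) → Subset n → ℚ
f̂ f []            = f []
f̂ f (outside ∷ S) = f̂ (λ x → ½ * (f (Sign.+ ∷ x) + f (Sign.- ∷ x))) S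
f̂ f (inside  ∷ S) = f̂ (λ x → ½ * (f (Sign.+ ∷ x) - f (Sign.- ∷ x))) S

∑-++ : ∀ {A : Set} (as bs : List A) g → ∑ (as ++ bs) g ≡ ∑ as g + ∑ bs g
∑-++ []       bs g = sym (ℚₚ.+-identityˡ _)
∑-++ (a ∷ as) bs g = trans (cong (λ r → g a + r) (∑-++ as bs g)) (sym (ℚₚ.+-assoc (g a) _ _))

∑-map : ∀ {A B : Set} (h : A → B) as g → ∑ (map h as) g ≡ ∑ as (g ∘ h)
∑-map h []       g = refl
∑-map h (a ∷ as) g = cong (λ r → g (h a) + r) (∑-map h as g)

∑-scale : ∀ {A : Set} (as : List A) c (a : A → ℚ) (b : A → ℚ) →
          ∑ as (λ S → a S * (c * b S)) ≡ c * ∑ as (λ S → a S * b S)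
∑-scale []       c a b = sym (ℚₚ.*-zeroʳ c)
∑-scale (S ∷ as) c a b = trans (cong (λ r → a S * (c * b S) + r) (∑-scale as c a b))
  (solve 4 (λ c x y r → x :* (c :* y) :+ c :* r := c :* (x :* y :+ r)) refl c (a S) (b S) _)
  where open +-*-Solver

∑-subsets : ∀ {n} (a : Subset (suc n) → ℚ) s (x : Point n) →
  ∑ (subsets (suc n)) (λ S → a S * χ S (s ∷ x)) ≡
  ∑ (subsets n) (λ S → a (outside ∷ S) * χ S x) + coord s * ∑ (subsets n) (λ S → a (inside ∷ S) * χ S x)
∑-subsets {n} a s x = trans (∑-++ (map (outside ∷_) (subsets n)) (map (inside ∷_) (subsets n)) g) (cong₂ _+_
  (∑-map (outside ∷_) (subsets n) g)
  (trans (∑-map (inside ∷_) (subsets n) g) (∑-scale (subsets n) (coord s) (λ S → a (inside ∷ S)) (λ S → χ S x))))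
  where
  g : Subset (suc n) → ℚ
  g S = a S * χ S (s ∷ x)

fourier-expansion : ∀ {n} (f : Point n → ℚ) x → f x ≡ ∑ (subsets n) (λ S → f̂ f S * χ S x)
fourier-expansion f [] = solve 1 (λ a → a := a :* con 1ℚ :+ con 0ℚ) refl (f [])
  where open +-*-Solver
fourier-expansion {suc n} f (s ∷ x) = begin
  f (s ∷ x)                ≡⟨ split s ⟩
  even x + coord s * odd x ≡⟨ cong₂ (λ u v → u + coord s * v) (fourier-expansion even x) (fourier-expansion odd x) ⟩
  _                        ≡⟨ sym (∑-subsets (f̂ f) s x) ⟩
  _                        ∎
  where
  open ≡-Reasoning
  open +-*-Solver
  even odd : Point n → ℚ
  even x = ½ * (f (Sign.+ ∷ x) + f (Sign.- ∷ x))
  odd  x = ½ * (f (Sign.+ ∷ x) - f (Sign.- ∷ x))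
  split : ∀ s → f (s ∷ x) ≡ even x + coord s * odd x
  split Sign.+ = solve 2 (λ a b → a := con ½ :* (a :+ b) :+ con 1ℚ :* (con ½ :* (a :- b))) refl (f (Sign.+ ∷ x)) (f (Sign.- ∷ x))
  split Sign.- = solve 2 (λ a b → b := con ½ :* (a :+ b) :+ con (- 1ℚ) :* (con ½ :* (a :- b))) refl (f (Sign.+ ∷ x)) (f (Sign.- ∷ x))

fourier-unique : ∀ {n} (f : Point n → ℚ) (a : Subset n → ℚ) →
                 (∀ x → f x ≡ ∑ (subsets n) (λ S → a S * χ S x)) → ∀ S → a S ≡ f̂ f S
fourier-unique f a eq [] = sym (trans (eq []) (solve 1 (λ a → a :* con 1ℚ :+ con 0ℚ := a) refl (a [])))
  where open +-*-Solver
fourier-unique {suc n} f a eq (outside ∷ S) = fourier-unique _ (λ S → a (outside ∷ S)) part S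
  where
  open +-*-Solver
  part : ∀ x → ½ * (f (Sign.+ ∷ x) + f (Sign.- ∷ x)) ≡ ∑ (subsets n) (λ S → a (outside ∷ S) * χ S x)
  part x = trans
    (cong₂ (λ u v → ½ * (u + v)) (trans (eq (Sign.+ ∷ x)) (∑-subsets a Sign.+ x)) (trans (eq (Sign.- ∷ x)) (∑-subsets a Sign.- x)))
    (solve 2 (λ u v → con ½ :* ((u :+ con 1ℚ :* v) :+ (u :+ con (- 1ℚ) :* v)) := u) refl
      (∑ (subsets n) (λ S → a (outside ∷ S) * χ S x)) (∑ (subsets n) (λ S → a (inside ∷ S) * χ S x)))
fourier-unique {suc n} f a eq (inside ∷ S) = fourier-unique _ (λ S → a (inside ∷ S)) part S
  where
  open +-*-Solver
  part : ∀ x → ½ * (f (Sign.+ ∷ x) - f (Sign.- ∷ x)) ≡ ∑ (subsets n) (λ S → a (inside ∷ S) * χ S x)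
  part x = trans
    (cong₂ (λ u v → ½ * (u - v)) (trans (eq (Sign.+ ∷ x)) (∑-subsets a Sign.+ x)) (trans (eq (Sign.- ∷ x)) (∑-subsets a Sign.- x)))
    (solve 2 (λ u v → con ½ :* ((u :+ con 1ℚ :* v) :- (u :+ con (- 1ℚ) :* v)) := v) refl
      (∑ (subsets n) (λ S → a (outside ∷ S) * χ S x)) (∑ (subsets n) (λ S → a (inside ∷ S) * χ S x)))

homogeneousPart : ∀ {n} → ℕ → (Point n → ℚ) → Point n → ℚ
homogeneousPart {n} ℓ f x = ∑ (filter (λ S → card S ℕₚ.≟ ℓ) (subsets n)) (λ S → f̂ f S * χ S x)

-- Starting the maximum at 0 is harmless: absolute values are nonnegative and
-- the cube is inhabited.

‖_‖∞ : ∀ {n} → (Point n → ℚ) → ℚ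
‖_‖∞ {n} f = foldr (λ x r → ∣ f x ∣ ⊔ r) 0ℚ (points n)

mean : ∀ n .{{_ : NonZero n}} → Point n → ℚ
mean n x = Vec.foldr′ (λ s r → coord s + r) 0ℚ x * (+ 1 / n)

chebyshevMean : ∀ n .{{_ : NonZero n}} → ℕ → Point n → ℚ
chebyshevMean n d x = eval (T d) (mean n x)

-- Reals are Cauchy sequences of rationals, compared by _≤ʳ_; different sequences
-- may represent the same real.

record ℝ : Set where
  constructor mkℝ
  field
    seq    : ℕ → ℚ
    cauchy : ∀ {ε} → 0ℚ < ε → ∃[ N ] ∀ {i j} → N ℕ.≤ i → N ℕ.≤ j → ∣ seq i - seq j ∣ ≤ ε

open ℝ using (seq; cauchy)

infix  4 _≤ʳ_
infixl 6 _+ʳ_ _-ʳ_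
infixl 7 _*ʳ_
infixr 8 _^ʳ_
infix  8 -ʳ_

_≤ʳ_ : ℝ → ℝ → Set
x ≤ʳ y = ∀ {ε} → 0ℚ < ε → ∃[ N ] ∀ {i} → N ℕ.≤ i → seq x i ≤ seq y i + ε

half-pos : ∀ {ε} → 0ℚ < ε → 0ℚ < ½ * ε
half-pos {ε} 0<ε = ℚₚ.positive⁻¹ (½ * ε) {{ℚₚ.pos*pos⇒pos ½ ε {{positive 0<ε}}}}

halves : ∀ ε → ½ * ε + ½ * ε ≡ ε
halves ε = solve 1 (λ ε → con ½ :* ε :+ con ½ :* ε := ε) refl ε
  where open +-*-Solver

ι : ℚ → ℝ
ι q = mkℝ (λ _ → q) λ 0<ε → 0 , λ _ _ → ℚₚ.≤-trans (ℚₚ.≤-reflexive (cong ∣_∣ (ℚₚ.+-inverseʳ q))) (ℚₚ.<⇒≤ 0<ε)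

-ʳ_ : ℝ → ℝ
-ʳ x = mkℝ (λ i → - seq x i) λ 0<ε → let (N , h) = cauchy x 0<ε in
  N , λ {i} {j} N≤i N≤j → ℚₚ.≤-trans (ℚₚ.≤-reflexive (eq (seq x i) (seq x j))) (h N≤i N≤j)
  where
  open +-*-Solver
  eq : ∀ a b → ∣ - a - - b ∣ ≡ ∣ a - b ∣
  eq a b = trans (cong ∣_∣ (solve 2 (λ a b → (:- a) :- (:- b) := :- (a :- b)) refl a b)) (ℚₚ.∣-p∣≡∣p∣ (a - b))

_+ʳ_ : ℝ → ℝ → ℝ
x +ʳ y = mkℝ (λ i → seq x i + seq y i) λ {ε} 0<ε →
  let (M , f) = cauchy x (half-pos 0<ε)
      (N , g) = cauchy y (half-pos 0<ε)
  in M ℕ.⊔ N , λ {i} {j} p q → begin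
    ∣ seq x i + seq y i - (seq x j + seq y j) ∣  ≡⟨ cong ∣_∣ (solve 4 (λ a b c d → a :+ b :- (c :+ d) := (a :- c) :+ (b :- d)) refl (seq x i) (seq y i) (seq x j) (seq y j)) ⟩
    ∣ (seq x i - seq x j) + (seq y i - seq y j) ∣  ≤⟨ ℚₚ.∣p+q∣≤∣p∣+∣q∣ (seq x i - seq x j) _ ⟩
    ∣ seq x i - seq x j ∣ + ∣ seq y i - seq y j ∣  ≤⟨ ℚₚ.+-mono-≤ (f (ℕₚ.m⊔n≤o⇒m≤o M N p) (ℕₚ.m⊔n≤o⇒m≤o M N q)) (g (ℕₚ.m⊔n≤o⇒n≤o M N p) (ℕₚ.m⊔n≤o⇒n≤o M N q)) ⟩
    ½ * ε + ½ * ε                                  ≡⟨ halves ε ⟩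
    ε                                              ∎
  where
  open ℚₚ.≤-Reasoning
  open +-*-Solver

_-ʳ_ : ℝ → ℝ → ℝ
x -ʳ y = x +ʳ (-ʳ y)

prefix-bound : (s : ℕ → ℚ) → ∀ N → ∃[ B ] 0ℚ ≤ B × (∀ {i} → i ℕ.≤ N → ∣ s i ∣ ≤ B)
prefix-bound s zero = ∣ s 0 ∣ , ℚₚ.nonNegative⁻¹ _ {{ℚₚ.∣-∣-nonNeg (s 0)}} , λ { z≤n → ℚₚ.≤-refl }
prefix-bound s (suc N) with prefix-bound s N
... | B , 0≤B , h = B ⊔ ∣ s (suc N) ∣ , ℚₚ.≤-trans 0≤B (ℚₚ.p≤p⊔q B _) , bound
  where
  bound : ∀ {i} → i ℕ.≤ suc N → ∣ s i ∣ ≤ B ⊔ ∣ s (suc N) ∣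
  bound i≤ with ℕₚ.m≤n⇒m<n∨m≡n i≤
  ... | inj₁ (s≤s i≤N) = ℚₚ.≤-trans (h i≤N) (ℚₚ.p≤p⊔q B _)
  ... | inj₂ refl      = ℚₚ.p≤q⊔p B _

seq-bound : ∀ x → ∃[ B ] 0ℚ < B × (∀ i → ∣ seq x i ∣ ≤ B)
seq-bound x with cauchy x (ℚₚ.positive⁻¹ 1ℚ)
... | N , h with prefix-bound (seq x) N
... | B , 0≤B , b = B + 1ℚ , ℚₚ.+-mono-≤-< 0≤B (ℚₚ.positive⁻¹ 1ℚ) , bound
  where
  open ℚₚ.≤-Reasoning
  open +-*-Solver
  bound : ∀ i → ∣ seq x i ∣ ≤ B + 1ℚ
  bound i with ℕₚ.≤-total i N
  ... | inj₁ i≤N = ℚₚ.≤-trans (b i≤N) (ℚₚ.≤-trans (ℚₚ.≤-reflexive (sym (ℚₚ.+-identityʳ B))) (ℚₚ.+-monoʳ-≤ B (ℚₚ.nonNegative⁻¹ 1ℚ)))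
  ... | inj₂ N≤i = begin
    ∣ seq x i ∣                        ≡⟨ cong ∣_∣ (solve 2 (λ a c → a := c :+ (a :- c)) refl (seq x i) (seq x N)) ⟩
    ∣ seq x N + (seq x i - seq x N) ∣  ≤⟨ ℚₚ.∣p+q∣≤∣p∣+∣q∣ (seq x N) _ ⟩
    ∣ seq x N ∣ + ∣ seq x i - seq x N ∣ ≤⟨ ℚₚ.+-mono-≤ (b ℕₚ.≤-refl) (h N≤i ℕₚ.≤-refl) ⟩
    B + 1ℚ                             ∎

quotient : ∀ {B ε} → 0ℚ < B → 0ℚ < ε → ∃[ δ ] 0ℚ < δ × B * δ ≡ ε
quotient {B} {ε} 0<B 0<ε = 1/ B * ε , ℚₚ.positive⁻¹ _ {{ℚₚ.pos*pos⇒pos (1/ B) ε}} ,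
  trans (sym (ℚₚ.*-assoc B (1/ B) ε)) (trans (cong (_* ε) (ℚₚ.*-inverseʳ B)) (ℚₚ.*-identityˡ ε))
  where
  instance
    B⁺ : Positive B
    B⁺ = positive 0<B
    ε⁺ : Positive ε
    ε⁺ = positive 0<ε
    B≢0 : ℚ.NonZero B
    B≢0 = ℚₚ.pos⇒nonZero B
    B⁻¹⁺ : Positive (1/ B)
    B⁻¹⁺ = ℚₚ.1/pos⇒pos B

∣*∣-mono : ∀ {p q a b} → ∣ p ∣ ≤ a → ∣ q ∣ ≤ b → ∣ p * q ∣ ≤ a * b
∣*∣-mono {p} {q} {a} {b} p≤a q≤b = begin
  ∣ p * q ∣     ≡⟨ ℚₚ.∣p*q∣≡∣p∣*∣q∣ p q ⟩
  ∣ p ∣ * ∣ q ∣ ≤⟨ ℚₚ.*-monoʳ-≤-nonNeg ∣ q ∣ {{ℚₚ.∣-∣-nonNeg q}} p≤a ⟩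
  a * ∣ q ∣     ≤⟨ ℚₚ.*-monoˡ-≤-nonNeg a {{nonNegative (ℚₚ.≤-trans (ℚₚ.nonNegative⁻¹ _ {{ℚₚ.∣-∣-nonNeg p}}) p≤a)}} q≤b ⟩
  a * b         ∎
  where open ℚₚ.≤-Reasoning

_*ʳ_ : ℝ → ℝ → ℝ
x *ʳ y = mkℝ (λ i → seq x i * seq y i) λ {ε} 0<ε →
  let (A , 0<A , a) = seq-bound x
      (B , 0<B , b) = seq-bound y
      (δ , 0<δ , Bδ) = quotient 0<B (half-pos 0<ε)
      (η , 0<η , Aη) = quotient 0<A (half-pos 0<ε)
      (M , f) = cauchy x 0<δ
      (N , g) = cauchy y 0<η
  in M ℕ.⊔ N , λ {i} {j} p q → begin
    ∣ seq x i * seq y i - seq x j * seq y j ∣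
      ≡⟨ cong ∣_∣ (solve 4 (λ a b c d → a :* b :- c :* d := b :* (a :- c) :+ c :* (b :- d)) refl (seq x i) (seq y i) (seq x j) (seq y j)) ⟩
    ∣ seq y i * (seq x i - seq x j) + seq x j * (seq y i - seq y j) ∣
      ≤⟨ ℚₚ.∣p+q∣≤∣p∣+∣q∣ (seq y i * (seq x i - seq x j)) _ ⟩
    ∣ seq y i * (seq x i - seq x j) ∣ + ∣ seq x j * (seq y i - seq y j) ∣
      ≤⟨ ℚₚ.+-mono-≤ (∣*∣-mono {seq y i} {seq x i - seq x j} (b i) (f (ℕₚ.m⊔n≤o⇒m≤o M N p) (ℕₚ.m⊔n≤o⇒m≤o M N q)))
                     (∣*∣-mono {seq x j} {seq y i - seq y j} (a j) (g (ℕₚ.m⊔n≤o⇒n≤o M N p) (ℕₚ.m⊔n≤o⇒n≤o M N q))) ⟩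
    B * δ + A * η  ≡⟨ cong₂ _+_ Bδ Aη ⟩
    ½ * ε + ½ * ε  ≡⟨ halves ε ⟩
    ε              ∎
  where
  open ℚₚ.≤-Reasoning
  open +-*-Solver

_^ʳ_ : ℝ → ℕ → ℝ
x ^ʳ zero  = ι 1ℚ
x ^ʳ suc k = x *ʳ x ^ʳ k

1/! : ℕ → ℚ
1/! k = _/_ (+ 1) (k !) {{k ℕₚ.!≢0}}

e-seq : ℕ → ℚ
e-seq zero    = 1/! 0
e-seq (suc m) = e-seq m + 1/! (suc m)

1/suc : ℕ → ℚ
1/suc k = + 1 / suc k

1/-* : ∀ m n .{{_ : NonZero m}} .{{_ : NonZero n}} .{{_ : NonZero (m ℕ.* n)}} →
       + 1 / (m ℕ.* n) ≡ (+ 1 / m) * (+ 1 / n)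
1/-* (suc m) (suc n) = ℚₚ.toℚᵘ-injective (begin
  ℚ.toℚᵘ (ℚ.fromℚᵘ (mkℚᵘ (+ 1) (n ℕ.+ m ℕ.* suc n)))  ≈⟨ ℚₚ.toℚᵘ-fromℚᵘ _ ⟩
  mkℚᵘ (+ 1) (n ℕ.+ m ℕ.* suc n)                      ≈⟨ ℚᵘₚ.*-cong (ℚₚ.toℚᵘ-fromℚᵘ (mkℚᵘ (+ 1) m)) (ℚₚ.toℚᵘ-fromℚᵘ (mkℚᵘ (+ 1) n)) ⟨
  ℚ.toℚᵘ (1/suc m) ℚᵘ.* ℚ.toℚᵘ (1/suc n)              ≈⟨ ℚₚ.toℚᵘ-homo-* (1/suc m) (1/suc n) ⟨
  ℚ.toℚᵘ (1/suc m * 1/suc n)                          ∎)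
  where open import Relation.Binary.Reasoning.Setoid ℚᵘₚ.≃-setoid

1/suc-cancel : ∀ k → (+ suc k / 1) * 1/suc k ≡ 1ℚ
1/suc-cancel k = ℚₚ.toℚᵘ-injective (begin
  ℚ.toℚᵘ ((+ suc k / 1) * 1/suc k)           ≈⟨ ℚₚ.toℚᵘ-homo-* (+ suc k / 1) (1/suc k) ⟩
  ℚ.toℚᵘ (+ suc k / 1) ℚᵘ.* ℚ.toℚᵘ (1/suc k)  ≈⟨ ℚᵘₚ.*-cong (ℚₚ.toℚᵘ-fromℚᵘ (mkℚᵘ (+ suc k) 0)) (ℚₚ.toℚᵘ-fromℚᵘ (mkℚᵘ (+ 1) k)) ⟩
  mkℚᵘ (+ suc k) 0 ℚᵘ.* mkℚᵘ (+ 1) k         ≈⟨ *≡* (cong +_ (lemma k)) ⟩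
  ℚ.toℚᵘ 1ℚ                                  ∎)
  where
  open import Relation.Binary.Reasoning.Setoid ℚᵘₚ.≃-setoid
  lemma : ∀ k → suc (k ℕ.* 1 ℕ.* 1) ≡ suc (k ℕ.+ 0 ℕ.+ 0)
  lemma k = cong suc (solve 1 (λ k → k :* con 1 :* con 1 := k :+ con 0 :+ con 0) refl k)
    where open ℕ-Solver

suc/1 : ∀ k → + suc (suc k) / 1 ≡ (+ suc k / 1) + 1ℚ
suc/1 k = ℚₚ.toℚᵘ-injective (begin
  ℚ.toℚᵘ (+ suc (suc k) / 1)               ≈⟨ ℚₚ.toℚᵘ-fromℚᵘ (mkℚᵘ (+ suc (suc k)) 0) ⟩
  mkℚᵘ (+ suc (suc k)) 0                   ≈⟨ *≡* (cong +_ (lemma k)) ⟩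
  mkℚᵘ (+ suc k) 0 ℚᵘ.+ ℚᵘ.1ℚᵘ             ≈⟨ ℚᵘₚ.+-cong (ℚₚ.toℚᵘ-fromℚᵘ (mkℚᵘ (+ suc k) 0)) ℚᵘₚ.≃-refl ⟨
  ℚ.toℚᵘ (+ suc k / 1) ℚᵘ.+ ℚ.toℚᵘ 1ℚ      ≈⟨ ℚₚ.toℚᵘ-homo-+ (+ suc k / 1) 1ℚ ⟨
  ℚ.toℚᵘ ((+ suc k / 1) + 1ℚ)              ∎)
  where
  open import Relation.Binary.Reasoning.Setoid ℚᵘₚ.≃-setoid
  lemma : ∀ k → suc (suc k) ℕ.* 1 ≡ (suc k ℕ.* 1 ℕ.+ 1) ℕ.* 1
  lemma k = solve 1 (λ k → (con 2 :+ k) :* con 1 := ((con 1 :+ k) :* con 1 :+ con 1) :* con 1) refl k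
    where open ℕ-Solver

1/suc-telescope : ∀ k → 1/suc (suc k) * 1/suc k ≡ 1/suc k - 1/suc (suc k)
1/suc-telescope k = begin
  b * a                              ≡⟨ solve 3 (λ a b p → b :* a := a :* ((p :+ con 1ℚ) :* b) :- b :* (p :* a)) refl a b p ⟩
  a * ((p + 1ℚ) * b) - b * (p * a)   ≡⟨ cong₂ (λ u v → a * u - b * v) (trans (cong (_* b) (sym (suc/1 k))) (1/suc-cancel (suc k))) (1/suc-cancel k) ⟩
  a * 1ℚ - b * 1ℚ                    ≡⟨ cong₂ _-_ (ℚₚ.*-identityʳ a) (ℚₚ.*-identityʳ b) ⟩
  a - b                              ∎
  where
  open ≡-Reasoning
  open +-*-Solver
  a b p : ℚ
  a = 1/suc k
  b = 1/suc (suc k)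
  p = + suc k / 1

1/suc-nonNeg : ∀ k → NonNegative (1/suc k)
1/suc-nonNeg k = ℚₚ.normalize-nonNeg 1 (suc k)

1/suc-≤ : ∀ {k m} → k ℕ.≤ m → 1/suc m ≤ 1/suc k
1/suc-≤ {k} {m} k≤m = ℚₚ.toℚᵘ-cancel-≤ (begin
  ℚ.toℚᵘ (1/suc m)  ≃⟨ ℚₚ.toℚᵘ-fromℚᵘ (mkℚᵘ (+ 1) m) ⟩
  mkℚᵘ (+ 1) m      ≤⟨ ℚᵘ.*≤* (ℤ.+≤+ (s≤s (ℕₚ.+-monoˡ-≤ 0 k≤m))) ⟩
  mkℚᵘ (+ 1) k      ≃⟨ ℚₚ.toℚᵘ-fromℚᵘ (mkℚᵘ (+ 1) k) ⟨
  ℚ.toℚᵘ (1/suc k)  ∎)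
  where open ℚᵘₚ.≤-Reasoning

1/!-suc : ∀ k → 1/! (suc k) ≡ 1/suc k * 1/! k
1/!-suc k = 1/-* (suc k) (k !) {{_}} {{k ℕₚ.!≢0}} {{suc k ℕₚ.!≢0}}

1/!-nonNeg : ∀ k → NonNegative (1/! k)
1/!-nonNeg k = ℚₚ.normalize-nonNeg 1 (k !) {{k ℕₚ.!≢0}}

1/!-≤1 : ∀ k → 1/! k ≤ 1ℚ
1/!-≤1 zero    = ℚₚ.≤-refl
1/!-≤1 (suc k) = begin
  1/! (suc k)      ≡⟨ 1/!-suc k ⟩
  1/suc k * 1/! k  ≤⟨ ℚₚ.*-monoˡ-≤-nonNeg (1/suc k) {{1/suc-nonNeg k}} (1/!-≤1 k) ⟩
  1/suc k * 1ℚ     ≡⟨ ℚₚ.*-identityʳ _ ⟩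
  1/suc k          ≤⟨ 1/suc-≤ {0} {k} z≤n ⟩
  1ℚ               ∎
  where open ℚₚ.≤-Reasoning

e-step : ∀ k → e-seq (suc (suc k)) + 1/suc (suc k) ≤ e-seq (suc k) + 1/suc k
e-step k = begin
  s + 1/! (suc (suc k)) + b      ≡⟨ cong (λ t → s + t + b) (1/!-suc (suc k)) ⟩
  s + b * 1/! (suc k) + b        ≤⟨ ℚₚ.+-monoˡ-≤ b (ℚₚ.+-monoʳ-≤ s (ℚₚ.*-monoˡ-≤-nonNeg b {{1/suc-nonNeg (suc k)}} 1/!≤a)) ⟩
  s + b * a + b                  ≡⟨ cong (λ t → s + t + b) (1/suc-telescope k) ⟩
  s + (a - b) + b                ≡⟨ solve 3 (λ s a b → s :+ (a :- b) :+ b := s :+ a) refl s a b ⟩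
  s + a                          ∎
  where
  open ℚₚ.≤-Reasoning
  open +-*-Solver
  s a b : ℚ
  s = e-seq (suc k)
  a = 1/suc k
  b = 1/suc (suc k)
  1/!≤a : 1/! (suc k) ≤ a
  1/!≤a = begin
    1/! (suc k)  ≡⟨ 1/!-suc k ⟩
    a * 1/! k    ≤⟨ ℚₚ.*-monoˡ-≤-nonNeg a {{1/suc-nonNeg k}} (1/!-≤1 k) ⟩
    a * 1ℚ       ≡⟨ ℚₚ.*-identityʳ a ⟩
    a            ∎

e-lower : ∀ {m n} → m ℕ.≤′ n → e-seq m ≤ e-seq n
e-lower ℕ.≤′-refl           = ℚₚ.≤-refl
e-lower (ℕ.≤′-step {n} m≤n) = ℚₚ.≤-trans (e-lower m≤n) (begin
  e-seq n                 ≡⟨ ℚₚ.+-identityʳ (e-seq n) ⟨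
  e-seq n + 0ℚ            ≤⟨ ℚₚ.+-monoʳ-≤ (e-seq n) (ℚₚ.nonNegative⁻¹ (1/! (suc n)) {{1/!-nonNeg (suc n)}}) ⟩
  e-seq n + 1/! (suc n)   ∎)
  where open ℚₚ.≤-Reasoning

e-upper : ∀ {m n} → m ℕ.≤′ n → e-seq (suc n) + 1/suc n ≤ e-seq (suc m) + 1/suc m
e-upper ℕ.≤′-refl           = ℚₚ.≤-refl
e-upper (ℕ.≤′-step {n} m≤n) = ℚₚ.≤-trans (e-step n) (e-upper m≤n)

interval : ∀ {l w u v} → l ≤ u → u ≤ l + w → l ≤ v → v ≤ l + w → ∣ u - v ∣ ≤ w
interval {l} {w} {u} {v} l≤u u≤ l≤v v≤ with ℚₚ.∣p∣≡p∨∣p∣≡-p (u - v)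
... | inj₁ eq = ℚₚ.≤-trans (ℚₚ.≤-reflexive eq) (diff u≤ l≤v)
  where
  diff : ∀ {u v} → u ≤ l + w → l ≤ v → u - v ≤ w
  diff {u} {v} u≤ l≤v = ℚₚ.≤-trans (ℚₚ.+-mono-≤ u≤ (ℚₚ.neg-antimono-≤ l≤v))
    (ℚₚ.≤-reflexive (solve 2 (λ l w → l :+ w :- l := w) refl l w))
    where open +-*-Solver
... | inj₂ eq = ℚₚ.≤-trans (ℚₚ.≤-reflexive (trans eq (solve 2 (λ u v → :- (u :- v) := v :- u) refl u v)))
  (ℚₚ.≤-trans (ℚₚ.+-mono-≤ v≤ (ℚₚ.neg-antimono-≤ l≤u)) (ℚₚ.≤-reflexive (solve 2 (λ l w → l :+ w :- l := w) refl l w)))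
  where open +-*-Solver

archimedean : ∀ {ε} → 0ℚ < ε → ∃[ N ] 1/suc N ≤ ε
archimedean {ℚ.mkℚ (+ zero) d c} (ℚ.*<* (ℤ.+<+ ()))
archimedean {ε@(ℚ.mkℚ (+ suc p) d c)} _ = d , ℚₚ.toℚᵘ-cancel-≤ (begin
  ℚ.toℚᵘ (1/suc d)    ≃⟨ ℚₚ.toℚᵘ-fromℚᵘ (mkℚᵘ (+ 1) d) ⟩
  mkℚᵘ (+ 1) d        ≤⟨ ℚᵘ.*≤* (ℤ.+≤+ (ℕₚ.*-monoˡ-≤ (suc d) {1} {suc p} (s≤s z≤n))) ⟩
  mkℚᵘ (+ suc p) d    ∎)
  where open ℚᵘₚ.≤-Reasoning

e : ℝ
e = mkℝ e-seq e-cauchy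
  where
  e-cauchy : ∀ {ε} → 0ℚ < ε → ∃[ N ] ∀ {i j} → N ℕ.≤ i → N ℕ.≤ j → ∣ e-seq i - e-seq j ∣ ≤ ε
  e-cauchy {ε} 0<ε with archimedean 0<ε
  ... | N , 1/N≤ε = suc N , λ p q → ℚₚ.≤-trans (interval (lower p) (upper p) (lower q) (upper q)) 1/N≤ε
    where
    open ℚₚ.≤-Reasoning
    lower : ∀ {i} → suc N ℕ.≤ i → e-seq (suc N) ≤ e-seq i
    lower p = e-lower (ℕₚ.≤⇒≤′ p)
    upper : ∀ {i} → suc N ℕ.≤ i → e-seq i ≤ e-seq (suc N) + 1/suc N
    upper {suc i} (s≤s p) = begin
      e-seq (suc i)            ≡⟨ ℚₚ.+-identityʳ _ ⟨
      e-seq (suc i) + 0ℚ       ≤⟨ ℚₚ.+-monoʳ-≤ (e-seq (suc i)) (ℚₚ.nonNegative⁻¹ (1/suc i) {{1/suc-nonNeg i}}) ⟩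
      e-seq (suc i) + 1/suc i  ≤⟨ e-upper (ℕₚ.≤⇒≤′ p) ⟩
      e-seq (suc N) + 1/suc N  ∎

{-# OPTIONS --safe #-}
module Submission where

-- Boundedness.  Pell's identity T_d(z)^2 + (1 - z^2) U_{d-1}(z)^2 = 1 gives
-- T_d(z)^2 <= 1 whenever z^2 <= 1, and the mean of n signs satisfies this
-- (`pell`, `T-square≤1`, `mean-square≤1`).
--
-- Lower bound.  At the all-ones point the j-th homogeneous part of f takes the
-- value A_j(f), the sum of the Fourier coefficients of f on sets of size j
-- (`level`, `homogeneousPart-ones`), so |A_l(f)| is at most the sup norm of f_l.
-- Multiplication by x_i sends χ_S to χ of the symmetric difference of S with
-- the singleton of i; counting the i outside and inside S gives, for every f,
--
--   A_j(mean * f) = ((n - j + 1) A_{j-1}(f) + (j + 1) A_{j+1}(f)) / n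
--
-- (`level-total`, `level-mean`).  With t_d(j) = A_j(T_d(mean)), the Chebyshev
-- recurrence becomes t_{d+2} = 2 W t_{d+1} - t_d, where W is the operator
-- on the right above (`walk`, `chebyshevLevel-step`).  The coefficients
-- C(d,j) obey the same recurrence with W replaced by the shift j - 1 -> j, they
-- agree with t_d for d = 0 and d = 1, and W differs from the shift by terms of
-- size (degree / n) (`walk-drift`).  Since t_d(j) vanishes for j > n, W at most
-- doubles the sup norm of t_d, whence |t_d(j)| <= d! (5/2)^d
-- (`chebyshevLevel-bound`); since t_d(j) also vanishes for j > d, a second
-- induction gives |t_d(j) - C(d,j)| <= 2 (d+1)! (5/2)^d / n (`error-bound`).
-- Finally 5/2 = 1 + 1 + 1/2 is a partial sum of the series for e.

open import Defs
open import Algebra.Bundles using (CommutativeRing)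
open import Data.Bool.Base using (true; false)
open import Data.Fin.Subset using (Subset; inside; outside) renaming (∣_∣ to card)
open import Data.Integer.Base using (+_)
import Data.Integer.Base as ℤ
import Data.Integer.Properties as ℤₚ
open import Data.List.Base using (List; []; _∷_; _++_; map; filter; foldr)
open import Data.List.Properties using (filter-++)
open import Data.List.Membership.Propositional using (_∈_)
open import Data.List.Membership.Propositional.Properties using (∈-++⁺ˡ; ∈-++⁺ʳ; ∈-map⁺)
open import Data.List.Relation.Unary.Any using (here; there)
open import Data.Nat.Base using (ℕ; zero; suc; NonZero; _!)
import Data.Nat.Base as ℕ
open import Data.Nat.DivMod using (_%_)
import Data.Nat.Properties as ℕₚ
open import Data.Product.Base using (_×_; _,_)
open import Data.Rational.Base using (ℚ; 0ℚ; 1ℚ; ½; -_; _+_; _*_; _-_; _≤_; _⊔_; _/_; ∣_∣; nonNegative)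
import Data.Rational.Base as ℚ
import Data.Rational.Properties as ℚₚ
open import Data.Rational.Solver using (module +-*-Solver)
open import Data.Rational.Unnormalised.Base as ℚᵘ using (mkℚᵘ; *≡*)
import Data.Rational.Unnormalised.Properties as ℚᵘₚ
open import Data.Sign.Base using (Sign)
open import Data.Sum.Base using (inj₁; inj₂)
import Data.Vec.Base as Vec
open import Data.Vec.Base using ([]; _∷_)
open import Relation.Nullary using (Dec; does)
open import Relation.Binary.PropositionalEquality using (_≡_; refl; sym; trans; cong; cong₂; module ≡-Reasoning)

open Polynomial ℚₚ.+-*-commutativeRing using (coeff; eval; T; eval-add; eval-scale; coeff-add; coeff-scale; coeff-T; T-degree)
open import Algebra.Properties.Semiring.Exp (CommutativeRing.semiring ℚₚ.+-*-commutativeRing) using (_^_)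

-- Inequalities between rationals

0≤+ : ∀ {p q} → 0ℚ ≤ p → 0ℚ ≤ q → 0ℚ ≤ p + q
0≤+ = ℚₚ.+-mono-≤

0≤* : ∀ {p q} → 0ℚ ≤ p → 0ℚ ≤ q → 0ℚ ≤ p * q
0≤* {p} {q} 0≤p 0≤q = ℚₚ.nonNegative⁻¹ (p * q)
  {{ℚₚ.nonNeg*nonNeg⇒nonNeg p {{nonNegative 0≤p}} q {{nonNegative 0≤q}}}}

≤-by-difference : ∀ {p q} r → 0ℚ ≤ r → q ≡ p + r → p ≤ q
≤-by-difference {p} {q} r 0≤r eq = begin
  p       ≡⟨ ℚₚ.+-identityʳ p ⟨
  p + 0ℚ  ≤⟨ ℚₚ.+-monoʳ-≤ p 0≤r ⟩
  p + r   ≡⟨ eq ⟨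
  q       ∎
  where open ℚₚ.≤-Reasoning

*-mono-≤ : ∀ {p q r s} → 0ℚ ≤ p → 0ℚ ≤ s → p ≤ q → r ≤ s → p * r ≤ q * s
*-mono-≤ {p} {q} {r} {s} 0≤p 0≤s p≤q r≤s = ℚₚ.≤-trans
  (ℚₚ.*-monoˡ-≤-nonNeg p {{nonNegative 0≤p}} r≤s)
  (ℚₚ.*-monoʳ-≤-nonNeg s {{nonNegative 0≤s}} p≤q)

p≤∣p∣ : ∀ p → p ≤ ∣ p ∣
p≤∣p∣ p with ℚₚ.≤-total 0ℚ p
... | inj₁ 0≤p = ℚₚ.≤-reflexive (sym (ℚₚ.0≤p⇒∣p∣≡p 0≤p))
... | inj₂ p≤0 = ℚₚ.≤-trans p≤0 (ℚₚ.0≤∣p∣ p)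

square≤1⇒≤1 : ∀ {p} → p * p ≤ 1ℚ → p ≤ 1ℚ
square≤1⇒≤1 {p} pp≤1 with ℚₚ.≤-total p 1ℚ
... | inj₁ p≤1 = p≤1
... | inj₂ 1≤p = begin
  p       ≡⟨ ℚₚ.*-identityˡ p ⟨
  1ℚ * p  ≤⟨ ℚₚ.*-monoʳ-≤-nonNeg p {{nonNegative (ℚₚ.≤-trans (ℚₚ.nonNegative⁻¹ 1ℚ) 1≤p)}} 1≤p ⟩
  p * p   ≤⟨ pp≤1 ⟩
  1ℚ      ∎
  where open ℚₚ.≤-Reasoning

square≤1⇒-1≤ : ∀ {p} → p * p ≤ 1ℚ → - 1ℚ ≤ p
square≤1⇒-1≤ {p} pp≤1 = ℚₚ.≤-trans (ℚₚ.neg-antimono-≤ (square≤1⇒≤1 { - p} (ℚₚ.≤-trans (ℚₚ.≤-reflexive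
  (solve 1 (λ p → :- p :* :- p := p :* p) refl p)) pp≤1)))
  (ℚₚ.≤-reflexive (solve 1 (λ p → :- :- p := p) refl p))
  where open +-*-Solver

-- Natural numbers as rationals

-- The inclusion of ℕ in ℚ, by recursion, so that nat (suc k) unfolds to
-- 1ℚ + nat k inside polynomial identities.
nat : ℕ → ℚ
nat zero    = 0ℚ
nat (suc k) = 1ℚ + nat k

nat-nonNeg : ∀ k → 0ℚ ≤ nat k
nat-nonNeg zero    = ℚₚ.≤-refl
nat-nonNeg (suc k) = 0≤+ (ℚₚ.nonNegative⁻¹ 1ℚ) (nat-nonNeg k)

nat-mono : ∀ {i j} → i ℕ.≤ j → nat i ≤ nat j
nat-mono {j = j} ℕ.z≤n   = nat-nonNeg j
nat-mono (ℕ.s≤s i≤j) = ℚₚ.+-monoʳ-≤ 1ℚ (nat-mono i≤j)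

nat-+ : ∀ i j → nat (i ℕ.+ j) ≡ nat i + nat j
nat-+ zero    j = sym (ℚₚ.+-identityˡ (nat j))
nat-+ (suc i) j = trans (cong (λ r → 1ℚ + r) (nat-+ i j)) (sym (ℚₚ.+-assoc 1ℚ (nat i) (nat j)))

nat-* : ∀ i j → nat (i ℕ.* j) ≡ nat i * nat j
nat-* zero    j = sym (ℚₚ.*-zeroˡ (nat j))
nat-* (suc i) j = begin
  nat (j ℕ.+ i ℕ.* j)    ≡⟨ nat-+ j (i ℕ.* j) ⟩
  nat j + nat (i ℕ.* j)  ≡⟨ cong (λ r → nat j + r) (nat-* i j) ⟩
  nat j + nat i * nat j  ≡⟨ solve 2 (λ a b → b :+ a :* b := (con 1ℚ :+ a) :* b) refl (nat i) (nat j) ⟩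
  nat (suc i) * nat j    ∎
  where
  open ≡-Reasoning
  open +-*-Solver

nat≡/1 : ∀ k → nat k ≡ + k / 1
nat≡/1 zero          = refl
nat≡/1 (suc zero)    = refl
nat≡/1 (suc (suc k)) = begin
  1ℚ + nat (suc k)      ≡⟨ cong (λ r → 1ℚ + r) (nat≡/1 (suc k)) ⟩
  1ℚ + + suc k / 1      ≡⟨ ℚₚ.+-comm 1ℚ (+ suc k / 1) ⟩
  + suc k / 1 + 1ℚ      ≡⟨ suc/1 k ⟨
  + suc (suc k) / 1     ∎
  where open ≡-Reasoning

nat-cancel : ∀ n .{{_ : NonZero n}} → nat n * (+ 1 / n) ≡ 1ℚ
nat-cancel (suc k) = trans (cong (_* 1/suc k) (nat≡/1 (suc k))) (1/suc-cancel k)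

/≡nat* : ∀ a n .{{_ : NonZero n}} → + a / n ≡ nat a * (+ 1 / n)
/≡nat* a (suc k) = trans (ℚₚ.toℚᵘ-injective (begin
  ℚ.toℚᵘ (+ a / suc k)                      ≈⟨ ℚₚ.toℚᵘ-fromℚᵘ (mkℚᵘ (+ a) k) ⟩
  mkℚᵘ (+ a) k                              ≈⟨ *≡* (cong₂ ℤ._*_ (sym (ℤₚ.*-identityʳ (+ a))) (cong (λ m → + suc m) (ℕₚ.+-identityʳ k))) ⟩
  mkℚᵘ (+ a) 0 ℚᵘ.* mkℚᵘ (+ 1) k            ≈⟨ ℚᵘₚ.*-cong (ℚₚ.toℚᵘ-fromℚᵘ (mkℚᵘ (+ a) 0)) (ℚₚ.toℚᵘ-fromℚᵘ (mkℚᵘ (+ 1) k)) ⟨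
  ℚ.toℚᵘ (+ a / 1) ℚᵘ.* ℚ.toℚᵘ (1/suc k)    ≈⟨ ℚₚ.toℚᵘ-homo-* (+ a / 1) (1/suc k) ⟨
  ℚ.toℚᵘ ((+ a / 1) * 1/suc k)              ∎)) (cong (_* 1/suc k) (sym (nat≡/1 a)))
  where open import Relation.Binary.Reasoning.Setoid ℚᵘₚ.≃-setoid

1/n-nonNeg : ∀ n .{{_ : NonZero n}} → 0ℚ ≤ + 1 / n
1/n-nonNeg (suc k) = ℚₚ.nonNegative⁻¹ (1/suc k) {{1/suc-nonNeg k}}

-- Chebyshev polynomials on the interval from -1 to 1

2ℚ : ℚ
2ℚ = 1ℚ + 1ℚ

T-recurrence : ∀ d z → eval (T (suc (suc d))) z ≡ 2ℚ * (z * eval (T (suc d)) z) - eval (T d) z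
T-recurrence d z = begin
  eval (T (suc (suc d))) z
    ≡⟨ eval-add (map (2ℚ *_) (0ℚ ∷ T (suc d))) (map (- 1ℚ *_) (T d)) z ⟩
  eval (map (2ℚ *_) (0ℚ ∷ T (suc d))) z + eval (map (- 1ℚ *_) (T d)) z
    ≡⟨ cong₂ _+_ (eval-scale 2ℚ (0ℚ ∷ T (suc d)) z) (eval-scale (- 1ℚ) (T d) z) ⟩
  2ℚ * (0ℚ + z * eval (T (suc d)) z) + - 1ℚ * eval (T d) z
    ≡⟨ solve 3 (λ z a b → con 2ℚ :* (con 0ℚ :+ z :* a) :+ con (- 1ℚ) :* b := con 2ℚ :* (z :* a) :- b)
         refl z (eval (T (suc d)) z) (eval (T d) z) ⟩
  2ℚ * (z * eval (T (suc d)) z) - eval (T d) z ∎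
  where
  open ≡-Reasoning
  open +-*-Solver

-- The value at z of the Chebyshev polynomial of the second kind of degree
-- d - 1, which is zero for d = 0.
U : ℕ → ℚ → ℚ
U zero    z = 0ℚ
U (suc d) z = z * U d z + eval (T d) z

-- The addition formula for cos (d θ + θ), with sin θ eliminated.
T-step : ∀ d z → eval (T (suc d)) z ≡ z * eval (T d) z + (z * z - 1ℚ) * U d z
T-step zero z = solve 1 (λ z → con 0ℚ :+ z :* (con 1ℚ :+ z :* con 0ℚ) :=
  z :* (con 1ℚ :+ z :* con 0ℚ) :+ (z :* z :- con 1ℚ) :* con 0ℚ) refl z
  where open +-*-Solver
T-step (suc d) z = begin
  eval (T (suc (suc d))) z    ≡⟨ T-recurrence d z ⟩
  2ℚ * (z * b) - a            ≡⟨ solve 3 (λ z a b → con 2ℚ :* (z :* b) :- a := z :* b :+ z :* b :- a) refl z a b ⟩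
  z * b + z * b - a           ≡⟨ cong (λ t → z * b + z * t - a) (T-step d z) ⟩
  z * b + z * (z * a + (z * z - 1ℚ) * u) - a
    ≡⟨ solve 4 (λ z a b u → z :* b :+ z :* (z :* a :+ (z :* z :- con 1ℚ) :* u) :- a :=
         z :* b :+ (z :* z :- con 1ℚ) :* (z :* u :+ a)) refl z a b u ⟩
  z * b + (z * z - 1ℚ) * (z * u + a) ∎
  where
  open ≡-Reasoning
  open +-*-Solver
  a b u : ℚ
  a = eval (T d) z
  b = eval (T (suc d)) z
  u = U d z

pell : ∀ d z → eval (T d) z * eval (T d) z + (1ℚ - z * z) * (U d z * U d z) ≡ 1ℚ
pell zero z = solve 1 (λ z → (con 1ℚ :+ z :* con 0ℚ) :* (con 1ℚ :+ z :* con 0ℚ) :+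
  (con 1ℚ :- z :* z) :* (con 0ℚ :* con 0ℚ) := con 1ℚ) refl z
  where open +-*-Solver
pell (suc d) z = begin
  t′ * t′ + (1ℚ - z * z) * (u′ * u′)  ≡⟨ cong (λ t → t * t + (1ℚ - z * z) * (u′ * u′)) (T-step d z) ⟩
  _  ≡⟨ solve 3 (λ z t u →
          (z :* t :+ (z :* z :- con 1ℚ) :* u) :* (z :* t :+ (z :* z :- con 1ℚ) :* u) :+
          (con 1ℚ :- z :* z) :* ((z :* u :+ t) :* (z :* u :+ t)) :=
          t :* t :+ (con 1ℚ :- z :* z) :* (u :* u)) refl z t u ⟩
  t * t + (1ℚ - z * z) * (u * u)      ≡⟨ pell d z ⟩
  1ℚ                                  ∎
  where
  open ≡-Reasoning
  open +-*-Solver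
  t t′ u u′ : ℚ
  t  = eval (T d) z
  t′ = eval (T (suc d)) z
  u  = U d z
  u′ = U (suc d) z

square-nonNeg : ∀ p → 0ℚ ≤ p * p
square-nonNeg p with ℚₚ.≤-total 0ℚ p
... | inj₁ 0≤p = 0≤* 0≤p 0≤p
... | inj₂ p≤0 = ℚₚ.≤-trans (0≤* 0≤-p 0≤-p)
  (ℚₚ.≤-reflexive (solve 1 (λ p → :- p :* :- p := p :* p) refl p))
  where
  open +-*-Solver
  0≤-p : 0ℚ ≤ - p
  0≤-p = ℚₚ.neg-antimono-≤ p≤0

T-square≤1 : ∀ d z → z * z ≤ 1ℚ → eval (T d) z * eval (T d) z ≤ 1ℚ
T-square≤1 d z zz≤1 = ≤-by-difference ((1ℚ - z * z) * (U d z * U d z))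
  (0≤* 0≤1-zz (square-nonNeg (U d z))) (sym (pell d z))
  where
  0≤1-zz : 0ℚ ≤ 1ℚ - z * z
  0≤1-zz = ℚₚ.≤-trans (ℚₚ.≤-reflexive (sym (ℚₚ.+-inverseʳ (z * z)))) (ℚₚ.+-monoˡ-≤ (- (z * z)) zz≤1)

-- The sum of the coordinates.
total : ∀ {n} → Point n → ℚ
total = Vec.foldr′ (λ s r → coord s + r) 0ℚ

∣coord∣≡1 : ∀ s → ∣ coord s ∣ ≡ 1ℚ
∣coord∣≡1 Sign.+ = refl
∣coord∣≡1 Sign.- = refl

∣total∣≤n : ∀ {n} (x : Point n) → ∣ total x ∣ ≤ nat n
∣total∣≤n [] = ℚₚ.≤-refl
∣total∣≤n (s ∷ x) = ℚₚ.≤-trans (ℚₚ.∣p+q∣≤∣p∣+∣q∣ (coord s) (total x))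
  (ℚₚ.+-mono-≤ (ℚₚ.≤-reflexive (∣coord∣≡1 s)) (∣total∣≤n x))

mean-square≤1 : ∀ n .{{_ : NonZero n}} x → mean n x * mean n x ≤ 1ℚ
mean-square≤1 n x = ℚₚ.≤-trans (p≤∣p∣ (m * m)) (∣*∣-mono {m} {m} ∣m∣≤1 ∣m∣≤1)
  where
  m : ℚ
  m = mean n x
  ∣m∣≤1 : ∣ m ∣ ≤ 1ℚ
  ∣m∣≤1 = ℚₚ.≤-trans
    (∣*∣-mono {total x} {+ 1 / n} (∣total∣≤n x) (ℚₚ.≤-reflexive (ℚₚ.0≤p⇒∣p∣≡p (1/n-nonNeg n))))
    (ℚₚ.≤-reflexive (nat-cancel n))

-- Level sums of Fourier coefficients

-- f (s ∷ x) = even f x + coord s * odd f x.  The bodies are those that occur in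
-- the recursion for f̂: by definition f̂ f (outside ∷ S) is f̂ (even f) S and
-- f̂ f (inside ∷ S) is f̂ (odd f) S.
even odd : ∀ {n} → (Point (suc n) → ℚ) → Point n → ℚ
even f x = ½ * (f (Sign.+ ∷ x) + f (Sign.- ∷ x))
odd  f x = ½ * (f (Sign.+ ∷ x) - f (Sign.- ∷ x))

-- The sequence a moved up by one place, with 0 in front.
shift : (ℕ → ℚ) → ℕ → ℚ
shift a zero    = 0ℚ
shift a (suc j) = a j

shift-cong : ∀ {a b} → (∀ i → a i ≡ b i) → ∀ j → shift a j ≡ shift b j
shift-cong a≗b zero    = refl
shift-cong a≗b (suc j) = a≗b j

-- level f j is the sum of the Fourier coefficients of f on the sets of size j:
-- those avoiding the first variable come from even f, and those containing it
-- from odd f with one element fewer left to choose.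
level : ∀ {n} → (Point n → ℚ) → ℕ → ℚ
level {zero}  f zero    = f []
level {zero}  f (suc j) = 0ℚ
level {suc n} f j       = level (even f) j + shift (level (odd f)) j

ones : ∀ n → Point n
ones n = Vec.replicate n Sign.+

filter-outside : ∀ {n} ℓ (as : List (Subset n)) →
  filter (λ S → card S ℕₚ.≟ ℓ) (map (outside ∷_) as) ≡ map (outside ∷_) (filter (λ S → card S ℕₚ.≟ ℓ) as)
filter-outside ℓ []       = refl
filter-outside ℓ (S ∷ as) with does (card S ℕₚ.≟ ℓ)
... | true  = cong ((outside ∷ S) ∷_) (filter-outside ℓ as)
... | false = filter-outside ℓ as

filter-inside : ∀ {n} ℓ (as : List (Subset n)) →
  filter (λ S → card S ℕₚ.≟ suc ℓ) (map (inside ∷_) as) ≡ map (inside ∷_) (filter (λ S → card S ℕₚ.≟ ℓ) as)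
filter-inside ℓ []       = refl
filter-inside ℓ (S ∷ as) with does (card S ℕₚ.≟ ℓ)
... | true  = cong ((inside ∷ S) ∷_) (filter-inside ℓ as)
... | false = filter-inside ℓ as

filter-inside-zero : ∀ {n} (as : List (Subset n)) →
  filter (λ S → card S ℕₚ.≟ 0) (map (inside ∷_) as) ≡ []
filter-inside-zero []       = refl
filter-inside-zero (S ∷ as) = filter-inside-zero as

-- Every character takes the value 1 at the all-ones point.
homogeneousPart-ones : ∀ {n} (f : Point n → ℚ) ℓ → homogeneousPart ℓ f (ones n) ≡ level f ℓ
homogeneousPart-ones {zero}  f zero    = solve 1 (λ a → a :* con 1ℚ :+ con 0ℚ := a) refl (f [])
  where open +-*-Solver
homogeneousPart-ones {zero}  f (suc ℓ) = refl
homogeneousPart-ones {suc n} f ℓ = begin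
  ∑ (filter (P? ℓ) (map (outside ∷_) (subsets n) ++ map (inside ∷_) (subsets n))) g
    ≡⟨ cong (λ as → ∑ as g) (filter-++ (P? ℓ) (map (outside ∷_) (subsets n)) (map (inside ∷_) (subsets n))) ⟩
  ∑ (filter (P? ℓ) (map (outside ∷_) (subsets n)) ++ filter (P? ℓ) (map (inside ∷_) (subsets n))) g
    ≡⟨ ∑-++ (filter (P? ℓ) (map (outside ∷_) (subsets n))) _ g ⟩
  ∑ (filter (P? ℓ) (map (outside ∷_) (subsets n))) g + ∑ (filter (P? ℓ) (map (inside ∷_) (subsets n))) g
    ≡⟨ cong₂ _+_ outer (inner ℓ) ⟩
  level f ℓ ∎
  where
  open ≡-Reasoning
  P? : ∀ {m} ℓ (S : Subset m) → Dec (card S ≡ ℓ)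
  P? ℓ S = card S ℕₚ.≟ ℓ
  g : Subset (suc n) → ℚ
  g S = f̂ f S * χ S (ones (suc n))
  outer : ∑ (filter (P? ℓ) (map (outside ∷_) (subsets n))) g ≡ level (even f) ℓ
  outer = begin
    ∑ (filter (P? ℓ) (map (outside ∷_) (subsets n))) g  ≡⟨ cong (λ as → ∑ as g) (filter-outside ℓ (subsets n)) ⟩
    ∑ (map (outside ∷_) (filter (P? ℓ) (subsets n))) g  ≡⟨ ∑-map (outside ∷_) (filter (P? ℓ) (subsets n)) g ⟩
    homogeneousPart ℓ (even f) (ones n)                 ≡⟨ homogeneousPart-ones (even f) ℓ ⟩
    level (even f) ℓ                                    ∎
  inner : ∀ ℓ → ∑ (filter (P? ℓ) (map (inside ∷_) (subsets n))) g ≡ shift (level (odd f)) ℓ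
  inner zero    = cong (λ as → ∑ as g) (filter-inside-zero (subsets n))
  inner (suc ℓ) = begin
    ∑ (filter (P? (suc ℓ)) (map (inside ∷_) (subsets n))) g  ≡⟨ cong (λ as → ∑ as g) (filter-inside ℓ (subsets n)) ⟩
    ∑ (map (inside ∷_) (filter (P? ℓ) (subsets n))) g        ≡⟨ ∑-map (inside ∷_) (filter (P? ℓ) (subsets n)) g ⟩
    ∑ (filter (P? ℓ) (subsets n)) (λ S → f̂ (odd f) S * (1ℚ * χ S (ones n)))
      ≡⟨ ∑-scale (filter (P? ℓ) (subsets n)) 1ℚ (f̂ (odd f)) (λ S → χ S (ones n)) ⟩
    1ℚ * homogeneousPart ℓ (odd f) (ones n)                  ≡⟨ ℚₚ.*-identityˡ _ ⟩
    homogeneousPart ℓ (odd f) (ones n)                       ≡⟨ homogeneousPart-ones (odd f) ℓ ⟩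
    level (odd f) ℓ                                          ∎

points-complete : ∀ {n} (x : Point n) → x ∈ points n
points-complete []           = here refl
points-complete (Sign.+ ∷ x) = ∈-++⁺ˡ (∈-map⁺ (Sign.+ ∷_) (points-complete x))
points-complete {suc n} (Sign.- ∷ x) = ∈-++⁺ʳ (map (Sign.+ ∷_) (points n)) (∈-map⁺ (Sign.- ∷_) (points-complete x))

∣f∣≤‖f‖∞ : ∀ {n} (f : Point n → ℚ) x → ∣ f x ∣ ≤ ‖ f ‖∞
∣f∣≤‖f‖∞ {n} f x = go (points-complete x)
  where
  go : ∀ {xs} → x ∈ xs → ∣ f x ∣ ≤ foldr (λ y r → ∣ f y ∣ ⊔ r) 0ℚ xs
  go (here refl)             = ℚₚ.p≤p⊔q ∣ f x ∣ _
  go {y ∷ xs} (there x∈xs)   = ℚₚ.≤-trans (go x∈xs) (ℚₚ.p≤q⊔p ∣ f y ∣ _)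

level-cong : ∀ {n} {f g : Point n → ℚ} → (∀ x → f x ≡ g x) → ∀ j → level f j ≡ level g j
level-cong {zero}  f≗g zero    = f≗g []
level-cong {zero}  f≗g (suc j) = refl
level-cong {suc n} f≗g j       = cong₂ _+_
  (level-cong (λ x → cong₂ (λ a b → ½ * (a + b)) (f≗g (Sign.+ ∷ x)) (f≗g (Sign.- ∷ x))) j)
  (shift-cong (level-cong (λ x → cong₂ (λ a b → ½ * (a - b)) (f≗g (Sign.+ ∷ x)) (f≗g (Sign.- ∷ x)))) j)

shift-linear : ∀ a b u v j → shift (λ i → a * u i + b * v i) j ≡ a * shift u j + b * shift v j
shift-linear a b u v zero    = solve 2 (λ a b → con 0ℚ := a :* con 0ℚ :+ b :* con 0ℚ) refl a b
  where open +-*-Solver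
shift-linear a b u v (suc j) = refl

level-linear : ∀ {n} a b (f g : Point n → ℚ) j →
  level (λ x → a * f x + b * g x) j ≡ a * level f j + b * level g j
level-linear {zero}  a b f g zero    = refl
level-linear {zero}  a b f g (suc j) = solve 2 (λ a b → con 0ℚ := a :* con 0ℚ :+ b :* con 0ℚ) refl a b
  where open +-*-Solver
level-linear {suc n} a b f g j = begin
  level (even h) j + shift (level (odd h)) j
    ≡⟨ cong₂ _+_
         (trans (level-cong even-linear j) (level-linear a b (even f) (even g) j))
         (trans (shift-cong (λ i → trans (level-cong odd-linear i) (level-linear a b (odd f) (odd g) i)) j)
                (shift-linear a b (level (odd f)) (level (odd g)) j)) ⟩
  (a * level (even f) j + b * level (even g) j) + (a * shift (level (odd f)) j + b * shift (level (odd g)) j)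
    ≡⟨ solve 6 (λ a b p q r s → (a :* p :+ b :* q) :+ (a :* r :+ b :* s) := a :* (p :+ r) :+ b :* (q :+ s))
         refl a b (level (even f) j) (level (even g) j) (shift (level (odd f)) j) (shift (level (odd g)) j) ⟩
  a * level f j + b * level g j ∎
  where
  open ≡-Reasoning
  open +-*-Solver
  h : Point (suc n) → ℚ
  h x = a * f x + b * g x
  even-linear : ∀ x → even h x ≡ a * even f x + b * even g x
  even-linear x = solve 6 (λ a b p q r s →
    con ½ :* ((a :* p :+ b :* q) :+ (a :* r :+ b :* s)) := a :* (con ½ :* (p :+ r)) :+ b :* (con ½ :* (q :+ s)))
    refl a b (f (Sign.+ ∷ x)) (g (Sign.+ ∷ x)) (f (Sign.- ∷ x)) (g (Sign.- ∷ x))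
  odd-linear : ∀ x → odd h x ≡ a * odd f x + b * odd g x
  odd-linear x = solve 6 (λ a b p q r s →
    con ½ :* ((a :* p :+ b :* q) :- (a :* r :+ b :* s)) := a :* (con ½ :* (p :- r)) :+ b :* (con ½ :* (q :- s)))
    refl a b (f (Sign.+ ∷ x)) (g (Sign.+ ∷ x)) (f (Sign.- ∷ x)) (g (Sign.- ∷ x))

level-vanishes : ∀ {n} (f : Point n → ℚ) {j} → n ℕ.< j → level f j ≡ 0ℚ
level-vanishes {zero}  f {suc j} _           = refl
level-vanishes {suc n} f {suc j} (ℕ.s≤s n<j) =
  cong₂ _+_ (level-vanishes (even f) (ℕₚ.m<n⇒m<1+n n<j)) (level-vanishes (odd f) n<j)

level-const : ∀ n c j → level {n} (λ _ → c) j ≡ coeff (c ∷ []) j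
level-const zero    c zero    = refl
level-const zero    c (suc j) = refl
level-const (suc n) c j = begin
  level {n} (λ _ → ½ * (c + c)) j + shift (level {n} (λ _ → ½ * (c - c))) j
    ≡⟨ cong₂ _+_
         (trans (level-cong {n} (λ _ → solve 1 (λ c → con ½ :* (c :+ c) := c) refl c) j) (level-const n c j))
         (shift-cong (λ i → trans (level-cong {n} (λ _ → solve 1 (λ c → con ½ :* (c :- c) := con 0ℚ) refl c) i) (level-const n 0ℚ i)) j) ⟩
  coeff (c ∷ []) j + shift (coeff (0ℚ ∷ [])) j  ≡⟨ cong (λ r → coeff (c ∷ []) j + r) (zeros j) ⟩
  coeff (c ∷ []) j + 0ℚ                         ≡⟨ ℚₚ.+-identityʳ _ ⟩
  coeff (c ∷ []) j                              ∎
  where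
  open ≡-Reasoning
  open +-*-Solver
  zeros : ∀ j → shift (coeff (0ℚ ∷ [])) j ≡ 0ℚ
  zeros zero          = refl
  zeros (suc zero)    = refl
  zeros (suc (suc j)) = refl

-- In the product of the coordinate sum with f, a coefficient of f at a set S with
-- i elements contributes n - i times to level i + 1 and i times to level i - 1.
level-total : ∀ {n} (f : Point n → ℚ) j → level (λ x → total x * f x) j ≡
  shift (λ i → (nat n - nat i) * level f i) j + nat (suc j) * level f (suc j)
level-total {zero} f zero = solve 1 (λ a → con 0ℚ :* a := con 0ℚ :+ (con 1ℚ :+ con 0ℚ) :* con 0ℚ) refl (f [])
  where open +-*-Solver
level-total {zero} f (suc zero) = solve 1 (λ a → con 0ℚ :=
  (con 0ℚ :- con 0ℚ) :* a :+ (con 1ℚ :+ (con 1ℚ :+ con 0ℚ)) :* con 0ℚ) refl (f [])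
  where open +-*-Solver
level-total {zero} f (suc (suc j)) = solve 1 (λ k → con 0ℚ :=
  (con 0ℚ :- (con 1ℚ :+ k)) :* con 0ℚ :+ (con 1ℚ :+ (con 1ℚ :+ (con 1ℚ :+ k))) :* con 0ℚ) refl (nat j)
  where open +-*-Solver
level-total {suc n} f j = trans (cong₂ _+_ (even-total j) (shift-cong odd-total j)) (combine j)
  where
  open ≡-Reasoning
  open +-*-Solver
  ev od : ℕ → ℚ
  ev = level (even f)
  od = level (odd f)
  se so : ℕ → ℚ
  se = level (λ x → total x * even f x)
  so = level (λ x → total x * odd f x)
  h : Point (suc n) → ℚ
  h x = total x * f x
  -- even and odd exchange roles when multiplied by the first coordinate.
  even-total : ∀ j → level (even h) j ≡ 1ℚ * se j + 1ℚ * od j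
  even-total j = trans (level-cong (λ x → solve 3 (λ s p q →
      con ½ :* ((con 1ℚ :+ s) :* p :+ (con (- 1ℚ) :+ s) :* q) :=
      con 1ℚ :* (s :* (con ½ :* (p :+ q))) :+ con 1ℚ :* (con ½ :* (p :- q)))
      refl (total x) (f (Sign.+ ∷ x)) (f (Sign.- ∷ x))) j)
    (level-linear 1ℚ 1ℚ (λ x → total x * even f x) (odd f) j)
  odd-total : ∀ j → level (odd h) j ≡ 1ℚ * so j + 1ℚ * ev j
  odd-total j = trans (level-cong (λ x → solve 3 (λ s p q →
      con ½ :* ((con 1ℚ :+ s) :* p :- (con (- 1ℚ) :+ s) :* q) :=
      con 1ℚ :* (s :* (con ½ :* (p :- q))) :+ con 1ℚ :* (con ½ :* (p :+ q)))
      refl (total x) (f (Sign.+ ∷ x)) (f (Sign.- ∷ x))) j)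
    (level-linear 1ℚ 1ℚ (λ x → total x * odd f x) (even f) j)
  weight : ∀ j → shift (λ i → (nat n - nat i) * od i) j ≡ (nat (suc n) - nat j) * shift od j
  weight zero    = sym (ℚₚ.*-zeroʳ (nat (suc n) - nat 0))
  weight (suc i) = solve 3 (λ n i a → (n :- i) :* a := ((con 1ℚ :+ n) :- (con 1ℚ :+ i)) :* a) refl (nat n) (nat i) (od i)
  combine : ∀ j → (1ℚ * se j + 1ℚ * od j) + shift (λ i → 1ℚ * so i + 1ℚ * ev i) j ≡
    shift (λ i → (nat (suc n) - nat i) * level f i) j + nat (suc j) * level f (suc j)
  combine zero = begin
    (1ℚ * se 0 + 1ℚ * od 0) + 0ℚ  ≡⟨ cong (λ t → (1ℚ * t + 1ℚ * od 0) + 0ℚ) (level-total (even f) 0) ⟩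
    (1ℚ * (0ℚ + (1ℚ + 0ℚ) * ev 1) + 1ℚ * od 0) + 0ℚ
      ≡⟨ solve 2 (λ ev od → (con 1ℚ :* (con 0ℚ :+ (con 1ℚ :+ con 0ℚ) :* ev) :+ con 1ℚ :* od) :+ con 0ℚ :=
           con 0ℚ :+ (con 1ℚ :+ con 0ℚ) :* (ev :+ od)) refl (ev 1) (od 0) ⟩
    0ℚ + (1ℚ + 0ℚ) * (ev 1 + od 0) ∎
  combine (suc j) = begin
    (1ℚ * se (suc j) + 1ℚ * od (suc j)) + (1ℚ * so j + 1ℚ * ev j)
      ≡⟨ cong₂ (λ s t → (1ℚ * s + 1ℚ * od (suc j)) + (1ℚ * t + 1ℚ * ev j))
           (level-total (even f) (suc j))
           (trans (level-total (odd f) j) (cong (λ w → w + nat (suc j) * od (suc j)) (weight j))) ⟩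
    (1ℚ * ((nat n - nat j) * ev j + nat (suc (suc j)) * ev (suc (suc j))) + 1ℚ * od (suc j)) +
      (1ℚ * ((nat (suc n) - nat j) * shift od j + nat (suc j) * od (suc j)) + 1ℚ * ev j)
      ≡⟨ solve 6 (λ n j ev e″ od o′ →
           (con 1ℚ :* ((n :- j) :* ev :+ (con 1ℚ :+ (con 1ℚ :+ j)) :* e″) :+ con 1ℚ :* o′) :+
           (con 1ℚ :* (((con 1ℚ :+ n) :- j) :* od :+ (con 1ℚ :+ j) :* o′) :+ con 1ℚ :* ev) :=
           ((con 1ℚ :+ n) :- j) :* (ev :+ od) :+ (con 1ℚ :+ (con 1ℚ :+ j)) :* (e″ :+ o′))
           refl (nat n) (nat j) (ev j) (ev (suc (suc j))) (shift od j) (od (suc j)) ⟩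
    (nat (suc n) - nat j) * (ev j + shift od j) + nat (suc (suc j)) * (ev (suc (suc j)) + od (suc j)) ∎

-- Multiplication by the mean as an operator on level sums

-- The operator that multiplication by the mean induces on level sums: from a set
-- of size i, toggling a uniformly random coordinate leads to size i + 1 with
-- probability (n - i) / n and to size i - 1 with probability i / n.
walk : ∀ n .{{_ : NonZero n}} → (ℕ → ℚ) → ℕ → ℚ
walk n a j = + 1 / n * (shift (λ i → (nat n - nat i) * a i) j + nat (suc j) * a (suc j))

walk-cong : ∀ n .{{_ : NonZero n}} {a b} → (∀ i → a i ≡ b i) → ∀ j → walk n a j ≡ walk n b j
walk-cong n a≗b j = cong₂ (λ u v → + 1 / n * (u + nat (suc j) * v))
  (shift-cong (λ i → cong ((nat n - nat i) *_) (a≗b i)) j) (a≗b (suc j))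

level-mean : ∀ n .{{_ : NonZero n}} (f : Point n → ℚ) j →
  level (λ x → mean n x * f x) j ≡ walk n (level f) j
level-mean n f j = begin
  level (λ x → mean n x * f x) j
    ≡⟨ level-cong (λ x → solve 3 (λ s v a → s :* v :* a := v :* (s :* a) :+ con 0ℚ :* a) refl (total x) (+ 1 / n) (f x)) j ⟩
  level (λ x → + 1 / n * (total x * f x) + 0ℚ * f x) j
    ≡⟨ level-linear (+ 1 / n) 0ℚ (λ x → total x * f x) f j ⟩
  + 1 / n * level (λ x → total x * f x) j + 0ℚ * level f j
    ≡⟨ solve 2 (λ a b → a :+ con 0ℚ :* b := a) refl (+ 1 / n * level (λ x → total x * f x) j) (level f j) ⟩
  + 1 / n * level (λ x → total x * f x) j
    ≡⟨ cong (+ 1 / n *_) (level-total f j) ⟩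
  walk n (level f) j ∎
  where
  open ≡-Reasoning
  open +-*-Solver

-- The value of the j-th homogeneous part of T d (mean) at the all-ones point.
chebyshevLevel : ∀ n .{{_ : NonZero n}} → ℕ → ℕ → ℚ
chebyshevLevel n d = level (chebyshevMean n d)

chebyshevLevel-0 : ∀ n .{{_ : NonZero n}} j → chebyshevLevel n 0 j ≡ C 0 j
chebyshevLevel-0 n j = trans
  (level-cong (λ x → solve 1 (λ z → con 1ℚ :+ z :* con 0ℚ := con 1ℚ) refl (mean n x)) j)
  (level-const n 1ℚ j)
  where open +-*-Solver

chebyshevLevel-1 : ∀ n .{{_ : NonZero n}} j → chebyshevLevel n 1 j ≡ C 1 j
chebyshevLevel-1 n j = begin
  chebyshevLevel n 1 j
    ≡⟨ level-cong (λ x → solve 1 (λ z → con 0ℚ :+ z :* (con 1ℚ :+ z :* con 0ℚ) := z :* con 1ℚ) refl (mean n x)) j ⟩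
  level (λ x → mean n x * 1ℚ) j    ≡⟨ level-mean n (λ _ → 1ℚ) j ⟩
  walk n (level {n} (λ _ → 1ℚ)) j  ≡⟨ walk-cong n (level-const n 1ℚ) j ⟩
  walk n (coeff (1ℚ ∷ [])) j       ≡⟨ first-step j ⟩
  C 1 j                            ∎
  where
  open ≡-Reasoning
  open +-*-Solver
  first-step : ∀ j → walk n (coeff (1ℚ ∷ [])) j ≡ C 1 j
  first-step zero          = solve 1 (λ v → v :* (con 0ℚ :+ (con 1ℚ :+ con 0ℚ) :* con 0ℚ) := con 0ℚ) refl (+ 1 / n)
  first-step (suc zero)    = trans
    (solve 2 (λ v n → v :* ((n :- con 0ℚ) :* con 1ℚ :+ (con 1ℚ :+ (con 1ℚ :+ con 0ℚ)) :* con 0ℚ) := n :* v) refl (+ 1 / n) (nat n))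
    (nat-cancel n)
  first-step (suc (suc j)) = solve 3 (λ v n k →
    v :* ((n :- (con 1ℚ :+ k)) :* con 0ℚ :+ (con 1ℚ :+ (con 1ℚ :+ (con 1ℚ :+ k))) :* con 0ℚ) := con 0ℚ) refl (+ 1 / n) (nat n) (nat j)

chebyshevLevel-step : ∀ n .{{_ : NonZero n}} d j → chebyshevLevel n (suc (suc d)) j ≡
  2ℚ * walk n (chebyshevLevel n (suc d)) j - chebyshevLevel n d j
chebyshevLevel-step n d j = begin
  chebyshevLevel n (suc (suc d)) j
    ≡⟨ level-cong (λ x → trans (T-recurrence d (mean n x))
         (solve 2 (λ a b → con 2ℚ :* a :- b := con 2ℚ :* a :+ con (- 1ℚ) :* b) refl (mean n x * chebyshevMean n (suc d) x) (chebyshevMean n d x))) j ⟩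
  level (λ x → 2ℚ * (mean n x * chebyshevMean n (suc d) x) + - 1ℚ * chebyshevMean n d x) j
    ≡⟨ level-linear 2ℚ (- 1ℚ) (λ x → mean n x * chebyshevMean n (suc d) x) (chebyshevMean n d) j ⟩
  2ℚ * level (λ x → mean n x * chebyshevMean n (suc d) x) j + - 1ℚ * chebyshevLevel n d j
    ≡⟨ cong (λ w → 2ℚ * w + - 1ℚ * chebyshevLevel n d j) (level-mean n (chebyshevMean n (suc d)) j) ⟩
  2ℚ * walk n (chebyshevLevel n (suc d)) j + - 1ℚ * chebyshevLevel n d j
    ≡⟨ solve 2 (λ a b → con 2ℚ :* a :+ con (- 1ℚ) :* b := con 2ℚ :* a :- b) refl (walk n (chebyshevLevel n (suc d)) j) (chebyshevLevel n d j) ⟩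
  2ℚ * walk n (chebyshevLevel n (suc d)) j - chebyshevLevel n d j ∎
  where
  open ≡-Reasoning
  open +-*-Solver

C-step : ∀ d j → C (suc (suc d)) j ≡ 2ℚ * shift (C (suc d)) j - C d j
C-step d zero = begin
  C (suc (suc d)) 0
    ≡⟨ coeff-add (map (2ℚ *_) (0ℚ ∷ T (suc d))) (map (- 1ℚ *_) (T d)) 0 ⟩
  2ℚ * 0ℚ + coeff (map (- 1ℚ *_) (T d)) 0
    ≡⟨ cong (λ r → 2ℚ * 0ℚ + r) (coeff-scale (- 1ℚ) (T d) 0) ⟩
  2ℚ * 0ℚ + - 1ℚ * C d 0
    ≡⟨ solve 1 (λ c → con 2ℚ :* con 0ℚ :+ con (- 1ℚ) :* c := con 2ℚ :* con 0ℚ :- c) refl (C d 0) ⟩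
  2ℚ * 0ℚ - C d 0 ∎
  where
  open ≡-Reasoning
  open +-*-Solver
C-step d (suc j) = trans (coeff-T d j)
  (solve 2 (λ a b → con 2ℚ :* a :+ con (- 1ℚ) :* b := con 2ℚ :* a :- b) refl (C (suc d) j) (C d (suc j)))
  where open +-*-Solver

-- Growth of the level sums

shift-bound : ∀ {a K} → 0ℚ ≤ K → (∀ i → ∣ a i ∣ ≤ K) → ∀ j → ∣ shift a j ∣ ≤ K
shift-bound 0≤K a≤ zero    = 0≤K
shift-bound 0≤K a≤ (suc j) = a≤ j

-- The bound M on the weights is needed only on the range where a may be nonzero.
weighted-bound : ∀ {m M B} (w a : ℕ → ℚ) → 0ℚ ≤ M → (∀ i → i ℕ.≤ m → ∣ w i ∣ ≤ M) →
  (∀ i → m ℕ.< i → a i ≡ 0ℚ) → (∀ i → ∣ a i ∣ ≤ B) → ∀ i → ∣ w i * a i ∣ ≤ M * B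
weighted-bound {m} {M} {B} w a 0≤M w≤ a≡0 a≤ i with ℕₚ.≤-<-connex i m
... | inj₁ i≤m = ∣*∣-mono {w i} {a i} (w≤ i i≤m) (a≤ i)
... | inj₂ m<i = begin
  ∣ w i * a i ∣  ≡⟨ cong ∣_∣ (trans (cong (w i *_) (a≡0 i m<i)) (ℚₚ.*-zeroʳ (w i))) ⟩
  0ℚ             ≤⟨ 0≤* 0≤M (ℚₚ.≤-trans (ℚₚ.0≤∣p∣ (a i)) (a≤ i)) ⟩
  M * B          ∎
  where open ℚₚ.≤-Reasoning

∣nat∣≤ : ∀ {i m} → i ℕ.≤ m → ∣ nat i ∣ ≤ nat m
∣nat∣≤ {i} i≤m = ℚₚ.≤-trans (ℚₚ.≤-reflexive (ℚₚ.0≤p⇒∣p∣≡p (nat-nonNeg i))) (nat-mono i≤m)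

∣n-i∣≤n : ∀ {i n} → i ℕ.≤ n → ∣ nat n - nat i ∣ ≤ nat n
∣n-i∣≤n {i} {n} i≤n = ℚₚ.≤-trans (ℚₚ.≤-reflexive (ℚₚ.0≤p⇒∣p∣≡p 0≤n-i))
  (≤-by-difference (nat i) (nat-nonNeg i) (solve 2 (λ n i → n := n :- i :+ i) refl (nat n) (nat i)))
  where
  open +-*-Solver
  0≤n-i : 0ℚ ≤ nat n - nat i
  0≤n-i = ℚₚ.≤-trans (ℚₚ.≤-reflexive (sym (ℚₚ.+-inverseʳ (nat i)))) (ℚₚ.+-monoˡ-≤ (- nat i) (nat-mono i≤n))

-- Both weights (n - i) / n and i / n lie between 0 and 1 on levels i ≤ n, the only
-- ones that are populated.
walk-bound : ∀ n .{{_ : NonZero n}} {a B} → (∀ i → n ℕ.< i → a i ≡ 0ℚ) → (∀ i → ∣ a i ∣ ≤ B) →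
  ∀ j → ∣ walk n a j ∣ ≤ 2ℚ * B
walk-bound n {a} {B} a≡0 a≤ j = begin
  ∣ walk n a j ∣
    ≤⟨ ∣*∣-mono {+ 1 / n} {up + down} (ℚₚ.≤-reflexive (ℚₚ.0≤p⇒∣p∣≡p (1/n-nonNeg n)))
         (ℚₚ.≤-trans (ℚₚ.∣p+q∣≤∣p∣+∣q∣ up down) (ℚₚ.+-mono-≤ up≤ down≤)) ⟩
  + 1 / n * (nat n * B + nat n * B)
    ≡⟨ solve 3 (λ v n b → v :* (n :* b :+ n :* b) := (n :* v) :* (con 2ℚ :* b)) refl (+ 1 / n) (nat n) B ⟩
  nat n * (+ 1 / n) * (2ℚ * B)  ≡⟨ cong (_* (2ℚ * B)) (nat-cancel n) ⟩
  1ℚ * (2ℚ * B)                 ≡⟨ ℚₚ.*-identityˡ _ ⟩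
  2ℚ * B                        ∎
  where
  open ℚₚ.≤-Reasoning
  open +-*-Solver
  up down : ℚ
  up   = shift (λ i → (nat n - nat i) * a i) j
  down = nat (suc j) * a (suc j)
  0≤B : 0ℚ ≤ B
  0≤B = ℚₚ.≤-trans (ℚₚ.0≤∣p∣ (a 0)) (a≤ 0)
  up≤ : ∣ up ∣ ≤ nat n * B
  up≤ = shift-bound (0≤* (nat-nonNeg n) 0≤B)
    (weighted-bound (λ i → nat n - nat i) a (nat-nonNeg n) (λ _ → ∣n-i∣≤n) a≡0 a≤) j
  down≤ : ∣ down ∣ ≤ nat n * B
  down≤ = weighted-bound nat a (nat-nonNeg n) (λ _ → ∣nat∣≤) a≡0 a≤ (suc j)

walk-vanishes : ∀ n .{{_ : NonZero n}} {a m} → (∀ i → m ℕ.< i → a i ≡ 0ℚ) → ∀ j → suc m ℕ.< j → walk n a j ≡ 0ℚ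
walk-vanishes n {a} {m} a≡0 (suc j) (ℕ.s≤s m<j) = trans
  (cong₂ (λ u v → + 1 / n * ((nat n - nat j) * u + nat (suc (suc j)) * v)) (a≡0 j m<j) (a≡0 (suc (suc j)) (ℕₚ.m<n⇒m<1+n (ℕₚ.m<n⇒m<1+n m<j))))
  (solve 3 (λ v x y → v :* (x :* con 0ℚ :+ y :* con 0ℚ) := con 0ℚ) refl (+ 1 / n) (nat n - nat j) (nat (suc (suc j))))
  where open +-*-Solver

chebyshevLevel-vanishes : ∀ n .{{_ : NonZero n}} d j → d ℕ.< j → chebyshevLevel n d j ≡ 0ℚ
chebyshevLevel-vanishes n zero          j d<j = trans (chebyshevLevel-0 n j) (T-degree 0 j d<j)
chebyshevLevel-vanishes n (suc zero)    j d<j = trans (chebyshevLevel-1 n j) (T-degree 1 j d<j)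
chebyshevLevel-vanishes n (suc (suc d)) j d<j = trans (chebyshevLevel-step n d j)
  (cong₂ (λ u v → 2ℚ * u - v)
    (walk-vanishes n (chebyshevLevel-vanishes n (suc d)) j d<j)
    (chebyshevLevel-vanishes n d j (ℕₚ.m+n≤o⇒n≤o 2 d<j)))

-- The partial sum 1 + 1 + 1/2 of the exponential series; it exceeds the growth
-- rate 1 + √2 of the recurrence a (d + 2) = 2 a (d + 1) + a d.
q : ℚ
q = + 5 / 2

-- The majorant d! (5/2)^d of the level sums of T d (mean).
growth : ℕ → ℚ
growth d = nat (d !) * q ^ d

^-nonNeg : ∀ {p} → 0ℚ ≤ p → ∀ k → 0ℚ ≤ p ^ k
^-nonNeg 0≤p zero    = ℚₚ.nonNegative⁻¹ 1ℚ
^-nonNeg 0≤p (suc k) = 0≤* 0≤p (^-nonNeg 0≤p k)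

0≤q : 0ℚ ≤ q
0≤q = ℚₚ.nonNegative⁻¹ q

growth-nonNeg : ∀ d → 0ℚ ≤ growth d
growth-nonNeg d = 0≤* (nat-nonNeg (d !)) (^-nonNeg 0≤q d)

growth-suc : ∀ d → growth (suc d) ≡ q * (nat (suc d) * growth d)
growth-suc d = trans (cong (_* (q * q ^ d)) (nat-* (suc d) (d !)))
  (solve 4 (λ q k f p → k :* f :* (q :* p) := q :* (k :* (f :* p))) refl q (nat (suc d)) (nat (d !)) (q ^ d))
  where open +-*-Solver

∣2p-r∣≤ : ∀ {p r P R} → ∣ p ∣ ≤ P → ∣ r ∣ ≤ R → ∣ 2ℚ * p - r ∣ ≤ 2ℚ * P + R
∣2p-r∣≤ {p} {r} p≤ r≤ = ℚₚ.≤-trans (ℚₚ.∣p-q∣≤∣p∣+∣q∣ (2ℚ * p) r)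
  (ℚₚ.+-mono-≤ (∣*∣-mono {2ℚ} {p} ℚₚ.≤-refl p≤) r≤)

C-0-bound : ∀ j → ∣ C 0 j ∣ ≤ 1ℚ
C-0-bound zero    = ℚₚ.≤-refl
C-0-bound (suc j) = ℚₚ.nonNegative⁻¹ 1ℚ

C-1-bound : ∀ j → ∣ C 1 j ∣ ≤ 1ℚ
C-1-bound zero          = ℚₚ.nonNegative⁻¹ 1ℚ
C-1-bound (suc zero)    = ℚₚ.≤-refl
C-1-bound (suc (suc j)) = ℚₚ.nonNegative⁻¹ 1ℚ

-- The recurrence a (d + 2) = 4 a (d + 1) + a d for the majorants outgrows
-- (5/2)^d; the factorial makes up for it.
chebyshevLevel-bound : ∀ n .{{_ : NonZero n}} d j → ∣ chebyshevLevel n d j ∣ ≤ growth d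
chebyshevLevel-bound n zero j = ℚₚ.≤-trans (ℚₚ.≤-reflexive (cong ∣_∣ (chebyshevLevel-0 n j))) (C-0-bound j)
chebyshevLevel-bound n (suc zero) j = ℚₚ.≤-trans (ℚₚ.≤-reflexive (cong ∣_∣ (chebyshevLevel-1 n j)))
  (ℚₚ.≤-trans (C-1-bound j) (≤-by-difference (+ 3 / 2) (ℚₚ.nonNegative⁻¹ (+ 3 / 2)) refl))
chebyshevLevel-bound n (suc (suc d)) j = begin
  ∣ chebyshevLevel n (suc (suc d)) j ∣  ≡⟨ cong ∣_∣ (chebyshevLevel-step n d j) ⟩
  ∣ 2ℚ * walk n (chebyshevLevel n (suc d)) j - chebyshevLevel n d j ∣
    ≤⟨ ∣2p-r∣≤ {walk n (chebyshevLevel n (suc d)) j} {chebyshevLevel n d j}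
         (walk-bound n (λ i → level-vanishes (chebyshevMean n (suc d)) {i}) (chebyshevLevel-bound n (suc d)) j)
         (chebyshevLevel-bound n d j) ⟩
  2ℚ * (2ℚ * growth (suc d)) + g                    ≡⟨ cong (λ t → 2ℚ * (2ℚ * t) + g) (growth-suc d) ⟩
  2ℚ * (2ℚ * (q * ((1ℚ + k) * g))) + g
    -- With k = d, the difference is (25/4 (k + 2)(k + 1) - 10 (k + 1) - 1) g.
    ≤⟨ ≤-by-difference ((+ 3 / 2 + (+ 35 / 4 * k + + 25 / 4 * (k * k))) * g)
         (0≤* (0≤+ (ℚₚ.nonNegative⁻¹ (+ 3 / 2)) (0≤+ (0≤* (ℚₚ.nonNegative⁻¹ (+ 35 / 4)) 0≤k) (0≤* (ℚₚ.nonNegative⁻¹ (+ 25 / 4)) (0≤* 0≤k 0≤k)))) (growth-nonNeg d))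
         (solve 2 (λ k g → con q :* ((con 1ℚ :+ (con 1ℚ :+ k)) :* (con q :* ((con 1ℚ :+ k) :* g))) :=
           con 2ℚ :* (con 2ℚ :* (con q :* ((con 1ℚ :+ k) :* g))) :+ g :+
           (con (+ 3 / 2) :+ (con (+ 35 / 4) :* k :+ con (+ 25 / 4) :* (k :* k))) :* g) refl k g) ⟩
  q * (nat (suc (suc d)) * (q * (nat (suc d) * g)))  ≡⟨ cong (λ t → q * (nat (suc (suc d)) * t)) (growth-suc d) ⟨
  q * (nat (suc (suc d)) * growth (suc d))           ≡⟨ growth-suc (suc d) ⟨
  growth (suc (suc d))                               ∎
  where
  open ℚₚ.≤-Reasoning
  open +-*-Solver
  k g : ℚ
  k = nat d
  g = growth d
  0≤k : 0ℚ ≤ k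
  0≤k = nat-nonNeg d

-- Comparison of level sums with Chebyshev coefficients

-- The walk is a shift up to terms carrying a factor (level / n).
walk-drift : ∀ n .{{_ : NonZero n}} a j → walk n a j ≡
  shift a j + + 1 / n * (nat (suc j) * a (suc j) - shift (λ i → nat i * a i) j)
walk-drift n a zero = solve 2 (λ v x → v :* (con 0ℚ :+ x) := con 0ℚ :+ v :* (x :- con 0ℚ)) refl (+ 1 / n) (nat 1 * a 1)
  where open +-*-Solver
walk-drift n a (suc j) = begin
  v * ((nat n - nat j) * a j + x)
    ≡⟨ solve 5 (λ v n j a x → v :* ((n :- j) :* a :+ x) := n :* v :* a :+ v :* (x :- j :* a)) refl v (nat n) (nat j) (a j) x ⟩
  nat n * v * a j + v * (x - nat j * a j)  ≡⟨ cong (λ t → t * a j + v * (x - nat j * a j)) (nat-cancel n) ⟩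
  1ℚ * a j + v * (x - nat j * a j)         ≡⟨ cong (_+ v * (x - nat j * a j)) (ℚₚ.*-identityˡ (a j)) ⟩
  a j + v * (x - nat j * a j)              ∎
  where
  open ≡-Reasoning
  open +-*-Solver
  v x : ℚ
  v = + 1 / n
  x = nat (suc (suc j)) * a (suc (suc j))

-- The gap between a level sum of T d (mean) and the coefficient of T d.
error : ∀ n .{{_ : NonZero n}} → ℕ → ℕ → ℚ
error n d j = chebyshevLevel n d j - C d j

-- 2 (d + 1)! (5/2)^d, which is n times the bound on the gap.
errorBound : ℕ → ℚ
errorBound d = 2ℚ * (nat (suc d) * growth d)

errorBound-nonNeg : ∀ d → 0ℚ ≤ errorBound d
errorBound-nonNeg d = 0≤* (ℚₚ.nonNegative⁻¹ 2ℚ) (0≤* (nat-nonNeg (suc d)) (growth-nonNeg d))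

error-exact : ∀ n .{{_ : NonZero n}} {d j} → chebyshevLevel n d j ≡ C d j → ∣ error n d j ∣ ≤ + 1 / n * errorBound d
error-exact n {d} {j} eq = begin
  ∣ error n d j ∣         ≡⟨ cong (λ t → ∣ t - C d j ∣) eq ⟩
  ∣ C d j - C d j ∣       ≡⟨ cong ∣_∣ (ℚₚ.+-inverseʳ (C d j)) ⟩
  0ℚ                      ≤⟨ 0≤* (1/n-nonNeg n) (errorBound-nonNeg d) ⟩
  + 1 / n * errorBound d  ∎
  where open ℚₚ.≤-Reasoning

shift-minus : ∀ a b j → shift (λ i → a i - b i) j ≡ shift a j - shift b j
shift-minus a b zero    = refl
shift-minus a b (suc j) = refl

error-bound : ∀ n .{{_ : NonZero n}} d j → ∣ error n d j ∣ ≤ + 1 / n * errorBound d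
error-bound n zero          j = error-exact n {0} (chebyshevLevel-0 n j)
error-bound n (suc zero)    j = error-exact n {1} (chebyshevLevel-1 n j)
error-bound n (suc (suc d)) j = begin
  ∣ error n (suc (suc d)) j ∣  ≡⟨ cong ∣_∣ recurrence ⟩
  ∣ 2ℚ * (shift (error n (suc d)) j + v * drift) - error n d j ∣
    ≤⟨ ∣2p-r∣≤ {shift (error n (suc d)) j + v * drift} {error n d j}
         (ℚₚ.≤-trans (ℚₚ.∣p+q∣≤∣p∣+∣q∣ (shift (error n (suc d)) j) (v * drift))
           (ℚₚ.+-mono-≤ (shift-bound (0≤* 0≤v (errorBound-nonNeg (suc d))) (error-bound n (suc d)) j)
             (∣*∣-mono {v} {drift} (ℚₚ.≤-reflexive (ℚₚ.0≤p⇒∣p∣≡p 0≤v)) drift≤)))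
         (error-bound n d j) ⟩
  2ℚ * (v * (2ℚ * (nat (suc (suc d)) * growth (suc d))) + v * (nat (suc d) * growth (suc d) + nat (suc d) * growth (suc d))) +
    v * (2ℚ * (nat (suc d) * g))
    ≡⟨ cong (λ t → 2ℚ * (v * (2ℚ * (nat (suc (suc d)) * t)) + v * (nat (suc d) * t + nat (suc d) * t)) +
         v * (2ℚ * (nat (suc d) * g))) (growth-suc d) ⟩
  -- Apart from the factor v (k + 1) g with k = d, the two sides are 20 k + 32 and
  -- 25/2 (k + 3)(k + 2).
  _ ≤⟨ ≤-by-difference (v * ((1ℚ + k) * ((+ 43 / 1 + (+ 85 / 2 * k + + 25 / 2 * (k * k))) * g)))
         (0≤* 0≤v (0≤* (0≤+ (ℚₚ.nonNegative⁻¹ 1ℚ) 0≤k) (0≤* (0≤+ (ℚₚ.nonNegative⁻¹ (+ 43 / 1)) (0≤+ (0≤* (ℚₚ.nonNegative⁻¹ (+ 85 / 2)) 0≤k) (0≤* (ℚₚ.nonNegative⁻¹ (+ 25 / 2)) (0≤* 0≤k 0≤k)))) (growth-nonNeg d))))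
         (solve 3 (λ v k g →
           let t = con q :* ((con 1ℚ :+ k) :* g) in
           v :* (con 2ℚ :* ((con 1ℚ :+ (con 1ℚ :+ (con 1ℚ :+ k))) :* (con q :* ((con 1ℚ :+ (con 1ℚ :+ k)) :* t)))) :=
           con 2ℚ :* (v :* (con 2ℚ :* ((con 1ℚ :+ (con 1ℚ :+ k)) :* t)) :+ v :* ((con 1ℚ :+ k) :* t :+ (con 1ℚ :+ k) :* t)) :+
             v :* (con 2ℚ :* ((con 1ℚ :+ k) :* g)) :+
           v :* ((con 1ℚ :+ k) :* ((con (+ 43 / 1) :+ (con (+ 85 / 2) :* k :+ con (+ 25 / 2) :* (k :* k))) :* g))) refl v k g) ⟩
  v * (2ℚ * (nat (suc (suc (suc d))) * (q * (nat (suc (suc d)) * (q * (nat (suc d) * g))))))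
    ≡⟨ cong (λ t → v * (2ℚ * (nat (suc (suc (suc d))) * t)))
         (trans (growth-suc (suc d)) (cong (λ t → q * (nat (suc (suc d)) * t)) (growth-suc d))) ⟨
  v * errorBound (suc (suc d)) ∎
  where
  open ℚₚ.≤-Reasoning
  open +-*-Solver
  v k g : ℚ
  v = + 1 / n
  k = nat d
  g = growth d
  0≤v : 0ℚ ≤ v
  0≤v = 1/n-nonNeg n
  0≤k : 0ℚ ≤ k
  0≤k = nat-nonNeg d
  t : ℕ → ℚ
  t = chebyshevLevel n (suc d)
  down up drift : ℚ
  down  = nat (suc j) * t (suc j)
  up    = shift (λ i → nat i * t i) j
  drift = down - up
  weighted≤ : ∀ i → ∣ nat i * t i ∣ ≤ nat (suc d) * growth (suc d)
  weighted≤ = weighted-bound nat t (nat-nonNeg (suc d)) (λ _ → ∣nat∣≤)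
    (chebyshevLevel-vanishes n (suc d)) (chebyshevLevel-bound n (suc d))
  drift≤ : ∣ drift ∣ ≤ nat (suc d) * growth (suc d) + nat (suc d) * growth (suc d)
  drift≤ = ℚₚ.≤-trans (ℚₚ.∣p-q∣≤∣p∣+∣q∣ down up)
    (ℚₚ.+-mono-≤ (weighted≤ (suc j)) (shift-bound (0≤* (nat-nonNeg (suc d)) (growth-nonNeg (suc d))) weighted≤ j))
  recurrence : error n (suc (suc d)) j ≡ 2ℚ * (shift (error n (suc d)) j + v * drift) - error n d j
  recurrence = begin-equality
    chebyshevLevel n (suc (suc d)) j - C (suc (suc d)) j
      ≡⟨ cong₂ _-_ (trans (chebyshevLevel-step n d j) (cong (λ w → 2ℚ * w - chebyshevLevel n d j) (walk-drift n t j))) (C-step d j) ⟩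
    (2ℚ * (shift t j + v * drift) - chebyshevLevel n d j) - (2ℚ * shift (C (suc d)) j - C d j)
      ≡⟨ solve 5 (λ s r x c e → (con 2ℚ :* (s :+ r) :- x) :- (con 2ℚ :* c :- e) := con 2ℚ :* ((s :- c) :+ r) :- (x :- e))
           refl (shift t j) (v * drift) (chebyshevLevel n d j) (shift (C (suc d)) j) (C d j) ⟩
    2ℚ * ((shift t j - shift (C (suc d)) j) + v * drift) - error n d j
      ≡⟨ cong (λ s → 2ℚ * (s + v * drift) - error n d j) (shift-minus t (C (suc d)) j) ⟨
    2ℚ * (shift (error n (suc d)) j + v * drift) - error n d j ∎

-- From the rational constant 5/2 to Euler's number

^-mono : ∀ {p r} → 0ℚ ≤ p → p ≤ r → ∀ k → p ^ k ≤ r ^ k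
^-mono 0≤p p≤r zero    = ℚₚ.≤-refl
^-mono 0≤p p≤r (suc k) = *-mono-≤ 0≤p (^-nonNeg (ℚₚ.≤-trans 0≤p p≤r) k) p≤r (^-mono 0≤p p≤r k)

seq-^ : ∀ x k i → ℝ.seq (x ^ʳ k) i ≡ ℝ.seq x i ^ k
seq-^ x zero    i = refl
seq-^ x (suc k) i = cong (ℝ.seq x i *_) (seq-^ x k i)

coefficient-bound : ∀ n .{{_ : NonZero n}} d ℓ →
  ∣ C d ℓ ∣ ≤ ‖ homogeneousPart ℓ (chebyshevMean n d) ‖∞ + + 1 / n * errorBound d
coefficient-bound n d ℓ = begin
  ∣ C d ℓ ∣                          ≡⟨ cong ∣_∣ (solve 2 (λ c t → c := t :- (t :- c)) refl (C d ℓ) t) ⟩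
  ∣ t - error n d ℓ ∣                ≤⟨ ℚₚ.∣p-q∣≤∣p∣+∣q∣ t (error n d ℓ) ⟩
  ∣ t ∣ + ∣ error n d ℓ ∣            ≤⟨ ℚₚ.+-mono-≤ t≤ (error-bound n d ℓ) ⟩
  ‖ homogeneousPart ℓ (chebyshevMean n d) ‖∞ + + 1 / n * errorBound d ∎
  where
  open ℚₚ.≤-Reasoning
  open +-*-Solver
  t : ℚ
  t = chebyshevLevel n d ℓ
  t≤ : ∣ t ∣ ≤ ‖ homogeneousPart ℓ (chebyshevMean n d) ‖∞
  t≤ = ℚₚ.≤-trans (ℚₚ.≤-reflexive (cong ∣_∣ (sym (homogeneousPart-ones (chebyshevMean n d) ℓ))))
    (∣f∣≤‖f‖∞ (homogeneousPart ℓ (chebyshevMean n d)) (ones n))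

errorBound≤ : ∀ n .{{_ : NonZero n}} d {p} → q ≤ p → + 1 / n * errorBound d ≤ + 2 / 1 * p ^ d * (+ (suc d !) / n)
errorBound≤ n d {p} q≤p = begin
  v * (2ℚ * (nat (suc d) * (nat (d !) * q ^ d)))
    ≡⟨ solve 4 (λ v k f w → v :* (con 2ℚ :* (k :* (f :* w))) := con (+ 2 / 1) :* w :* (k :* f :* v)) refl v (nat (suc d)) (nat (d !)) (q ^ d) ⟩
  + 2 / 1 * q ^ d * (nat (suc d) * nat (d !) * v)
    ≡⟨ cong (+ 2 / 1 * q ^ d *_) (trans (/≡nat* (suc d !) n) (cong (_* v) (nat-* (suc d) (d !)))) ⟨
  + 2 / 1 * q ^ d * (+ (suc d !) / n)
    ≤⟨ *-mono-≤ (0≤* 0≤2 (^-nonNeg 0≤q d)) 0≤f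
         (*-mono-≤ 0≤2 (^-nonNeg (ℚₚ.≤-trans 0≤q q≤p) d) (ℚₚ.≤-refl {+ 2 / 1}) (^-mono 0≤q q≤p d)) ℚₚ.≤-refl ⟩
  + 2 / 1 * p ^ d * (+ (suc d !) / n) ∎
  where
  open ℚₚ.≤-Reasoning
  open +-*-Solver
  v : ℚ
  v = + 1 / n
  0≤2 : 0ℚ ≤ + 2 / 1
  0≤2 = ℚₚ.nonNegative⁻¹ (+ 2 / 1)
  0≤f : 0ℚ ≤ + (suc d !) / n
  0≤f = ℚₚ.≤-trans (0≤* (nat-nonNeg (suc d !)) (1/n-nonNeg n)) (ℚₚ.≤-reflexive (sym (/≡nat* (suc d !) n)))

proposition2 : ∀ (n d ℓ : ℕ) .{{_ : NonZero n}} → d % 2 ≡ ℓ % 2 →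
    (∀ x → - 1ℚ ≤ chebyshevMean n d x × chebyshevMean n d x ≤ 1ℚ) ×
    (ι ∣ C d ℓ ∣ -ʳ ι (+ 2 / 1) *ʳ e ^ʳ d *ʳ ι (+ (suc d !) / n)
    ≤ʳ ι ‖ homogeneousPart ℓ (chebyshevMean n d) ‖∞)
proposition2 n d ℓ _ =
  (λ x → let T²≤1 = T-square≤1 d (mean n x) (mean-square≤1 n x) in square≤1⇒-1≤ T²≤1 , square≤1⇒≤1 T²≤1) ,
  -- From index 2 on, the partial sums representing e are at least 5/2.
  λ {ε} 0<ε → 2 , λ {i} 2≤i → begin
    c - + 2 / 1 * ℝ.seq (e ^ʳ d) i * r     ≡⟨ cong (λ p → c - + 2 / 1 * p * r) (seq-^ e d i) ⟩
    c - + 2 / 1 * ℝ.seq e i ^ d * r        ≤⟨ ℚₚ.+-mono-≤ (coefficient-bound n d ℓ) (ℚₚ.neg-antimono-≤ (errorBound≤ n d (e-lower (ℕₚ.≤⇒≤′ 2≤i)))) ⟩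
    N + + 1 / n * errorBound d - + 1 / n * errorBound d
                                           ≡⟨ solve 2 (λ a b → a :+ b :- b := a :+ con 0ℚ) refl N (+ 1 / n * errorBound d) ⟩
    N + 0ℚ                                 ≤⟨ ℚₚ.+-monoʳ-≤ N (ℚₚ.<⇒≤ 0<ε) ⟩
    N + ε                                  ∎
  where
  open ℚₚ.≤-Reasoning
  open +-*-Solver
  c r N : ℚ
  c = ∣ C d ℓ ∣
  r = + (suc d !) / n
  N = ‖ homogeneousPart ℓ (chebyshevMean n d) ‖∞
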